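{- For every $n\ge 1$, the graph $S(n,3)$ has nested solutions for the edge-isoperimetric problem given by lexicographic order; that is, for every integer $\ell$ with $0\le \ell\le 3^n$, the set $Lex^{ -1}(\{1,2,\dots,\ell\})$ satisfies $$|\Theta(Lex^{ -1}(\{1,\dots,\ell\}))|=\min\{|\Theta(S)| : S\subseteq V_{S(n,3)},\ |S|=\ell\}.$$
   Context: For $n\ge 1$, $m\ge 2$, the generalized and expanded Sierpinski graph $S(n,m)$ has vertex set $V_{S(n,m)}=\{0,1,\dots,m-1\}^n$; two distinct vertices $u,v$ are joined by an edge iff there is $h\in\{1,\dots,n\}$ such that $u_i=v_i$ for $1\le i<h$, $u_h\ne v_h$, and $u_j=v_h$, $v_j=u_h$ for all $h<j\le n$. For a graph $G=(V,E)$ and $S\subseteq V$, the edge-boundary is $\Theta(S)=\{\{v,w\}\in E: v\in S,\ w\notin S\}$. The lexicographic numbering $Lex:\{0,\dots,m-1\}^n\to\{1,\dots,m^n\}$ is $Lex(v)=1+\sum_{i=1}^n v_i m^{n-i}$. -}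

module Defs where

open import Data.Bool.Base using (Bool; true; false)
import Data.Bool.Properties as Bool
open import Data.Fin.Base using (Fin; toℕ; _<_)
import Data.Fin.Properties as Fin
open import Data.List.Base
  using (List; []; _∷_; length; filter; allFin; cartesianProduct; cartesianProductWith)
open import Data.List.Membership.Propositional using (_∈_)
open import Data.List.Membership.Propositional.Properties
  using (∈-allFin; ∈-cartesianProductWith⁺)
open import Data.List.Relation.Unary.Any using (here)
open import Data.List.Relation.Unary.All using ([])
open import Data.List.Relation.Unary.AllPairs using ([]; _∷_)
open import Data.List.Relation.Unary.Unique.Propositional using (Unique)
open import Data.List.Relation.Unary.Unique.Propositional.Properties
  using (allFin⁺; cartesianProductWith⁺)
open import Data.Nat.Base using (ℕ; zero; suc; _+_; _*_; _∸_; _^_; _≤_)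
open import Data.Nat.Properties using (_≤?_)
open import Data.Product.Base using (_×_; _,_; ∃-syntax)
open import Data.Vec.Base as Vec using (Vec; []; _∷_; lookup; tabulate)
open import Data.Vec.Properties using (≡-dec; ∷-injective)
open import Level using (0ℓ)
open import Relation.Binary.Core using (Rel)
open import Relation.Binary.Definitions using (Decidable; Symmetric)
open import Relation.Binary.PropositionalEquality using (_≡_; _≢_; refl; sym; ≢-sym)
open import Relation.Nullary using (¬_; Dec; ⌊_⌋)
open import Relation.Nullary.Decidable using (¬?; _×-dec_; _→-dec_)
open import Relation.Unary using (Pred)

record FiniteGraph : Set₁ where
  infix 4 _∼_ _∼?_
  field
    V        : Set
    vertices : List V
    unique   : Unique vertices
    complete : ∀ v → v ∈ vertices
    _∼_      : Rel V 0ℓ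
    _∼?_     : Decidable _∼_
    ∼-sym    : Symmetric _∼_
    ∼-irrefl : ∀ {v} → ¬ (v ∼ v)

  Subset : Set
  Subset = V → Bool

  ∣_∣ : Subset → ℕ
  ∣ S ∣ = length (filter (λ v → S v Bool.≟ true) vertices)

  -- An edge {v , w} of the boundary has exactly one endpoint in S, so it is
  -- listed exactly once: as the pair whose first component lies in S.
  Θ : Subset → List (V × V)
  Θ S = filter (λ (v , w) → v ∼? w ×-dec S v Bool.≟ true ×-dec S w Bool.≟ false)
               (cartesianProduct vertices vertices)

  ∣Θ_∣ : Subset → ℕ
  ∣Θ S ∣ = length (Θ S)

Word : ℕ → ℕ → Set
Word n m = Vec (Fin m) n

words : ∀ n m → List (Word n m)
words zero    m = [] ∷ []
words (suc n) m = cartesianProductWith _∷_ (allFin m) (words n m)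

words-unique : ∀ n m → Unique (words n m)
words-unique zero    m = [] ∷ []
words-unique (suc n) m =
  cartesianProductWith⁺ _∷_ ∷-injective (allFin⁺ m) (words-unique n m)

words-complete : ∀ {n m} (v : Word n m) → v ∈ words n m
words-complete []      = here refl
words-complete (x ∷ v) = ∈-cartesianProductWith⁺ _∷_ (∈-allFin x) (words-complete v)

JoinedAt : ∀ {n m} → Word n m → Word n m → Fin n → Set
JoinedAt u v h =
    (∀ i → i < h → lookup u i ≡ lookup v i)
  × lookup u h ≢ lookup v h
  × (∀ j → h < j → lookup u j ≡ lookup v h × lookup v j ≡ lookup u h)

joinedAt? : ∀ {n m} (u v : Word n m) (h : Fin n) → Dec (JoinedAt u v h)
joinedAt? u v h =
        Fin.all? (λ i → (i Fin.<? h) →-dec (lookup u i Fin.≟ lookup v i))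
  ×-dec ¬? (lookup u h Fin.≟ lookup v h)
  ×-dec Fin.all? (λ j → (h Fin.<? j) →-dec
          (lookup u j Fin.≟ lookup v h ×-dec lookup v j Fin.≟ lookup u h))

Joined : ∀ {n m} → Rel (Word n m) 0ℓ
Joined u v = u ≢ v × ∃[ h ] JoinedAt u v h

joined? : ∀ {n m} → Decidable (Joined {n} {m})
joined? u v = ¬? (≡-dec Fin._≟_ u v) ×-dec Fin.any? (joinedAt? u v)

joined-sym : ∀ {n m} → Symmetric (Joined {n} {m})
joined-sym (u≢v , h , eq , neq , swap) =
  ≢-sym u≢v , h , (λ i i<h → sym (eq i i<h)) , ≢-sym neq ,
  (λ j h<j → let (p , q) = swap j h<j in q , p)

Sierpinski : ℕ → ℕ → FiniteGraph
Sierpinski n m = record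
  { V        = Word n m
  ; vertices = words n m
  ; unique   = words-unique n m
  ; complete = words-complete
  ; _∼_      = Joined
  ; _∼?_     = joined?
  ; ∼-sym    = joined-sym
  ; ∼-irrefl = λ (v≢v , _) → v≢v refl
  }

-- Positions i : Fin n are counted from 0, whence the exponent n ∸ suc i.
Lex : ∀ {n m} → Word n m → ℕ
Lex {n} {m} v = 1 + Vec.sum (tabulate λ i → toℕ (lookup v i) * m ^ (n ∸ suc (toℕ i)))

Lex⁻¹[1⋯_] : ∀ {n m} → ℕ → FiniteGraph.Subset (Sierpinski n m)
Lex⁻¹[1⋯ ℓ ] v = ⌊ (1 ≤? Lex v) ×-dec (Lex v ≤? ℓ) ⌋

IsMinimumOf : ℕ → Pred ℕ 0ℓ → Set
IsMinimumOf k A = A k × (∀ j → A j → k ≤ j)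

{-# OPTIONS --safe #-}
module Submission where

-- S(n+1,3) consists of three copies of S(n,3), any two of which are joined by an edge between
-- corners.  Let Φ(S) be |Θ(S)| plus the number of corners in S, that is, the edge boundary after a
-- pendant edge has been attached at each corner.  In terms of the traces S₀, S₁, S₂ on the copies,
-- Φ(S) = Φ(S₀) + Φ(S₁) + Φ(S₂) − 2E, where E counts the joining edges inside S.  By induction,
-- initial segments minimise Φ.  Their values φ satisfy φ(a + b) + 2 ≤ φ(a) + φ(b) for a, b ≥ 1,
-- which settles E ≤ 2; for E = 3, either some Sᵢ has at least two corners although it fills less
-- than half of its copy, and then Φ(Sᵢ) ≥ φ(|Sᵢ|) + 2, or all Sᵢ are large and one passes to
-- complements.  Finally, Φ(S) + Φ(Sᶜ) = 2|Θ(S)| + 3, so minimising Φ minimises |Θ|.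

open import Defs
open import Data.Bool.Base using (Bool; true; false; not; _∧_; _∨_; if_then_else_)
import Data.Bool.Properties as Bool
open import Data.Fin.Base using (Fin; zero; suc; toℕ)
open import Data.Fin.Patterns using (0F; 1F; 2F)
import Data.Fin.Properties as Fin
open import Data.List.Base as List using (List; []; _∷_; _++_; length; filter; cartesianProduct)
open import Data.List.Properties using (map-++; map-∘; map-cong)
open import Data.Nat.Base
open import Data.Nat.ListAction using (sum)
open import Data.Nat.ListAction.Properties using (sum-++)
open import Data.Nat.Properties
open import Data.Nat.Tactic.RingSolver using (solve-∀)
open import Data.Product.Base using (_×_; _,_; proj₁; proj₂; ∃-syntax)
open import Data.Sum.Base using (_⊎_; inj₁; inj₂)
open import Data.Vec.Base using ([]; _∷_; lookup; replicate)
open import Data.Vec.Properties using (lookup-replicate; ∷-injectiveʳ)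
open import Function.Base using (_∘_)
open import Function.Bundles using (mk⇔)
open import Level using (0ℓ)
open import Relation.Binary.PropositionalEquality
open import Relation.Nullary using (¬_; yes; no; does; contradiction)
open import Relation.Nullary.Decidable using (dec-true; dec-false; does-⇔; isYes≗does)
open import Relation.Unary using (Pred; Decidable)

-- The edge boundary by recursion over the copies

Set[_] : ℕ → Set
Set[ n ] = Word n 3 → Bool

bit : Bool → ℕ
bit b = if b then 1 else 0

-- Recursion on the leading letter makes a sum fall apart into the contributions of the three copies
-- by computation alone.
∑ : ∀ n → (Word n 3 → ℕ) → ℕ
∑ zero    f = f []
∑ (suc n) f = ∑ n (f ∘ (0F ∷_)) + (∑ n (f ∘ (1F ∷_)) + ∑ n (f ∘ (2F ∷_)))

∑-cong : ∀ n {f g : Word n 3 → ℕ} → f ≗ g → ∑ n f ≡ ∑ n g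
∑-cong zero    f≗g = f≗g []
∑-cong (suc n) f≗g =
  cong₂ _+_ (∑-cong n (f≗g ∘ (0F ∷_)))
    (cong₂ _+_ (∑-cong n (f≗g ∘ (1F ∷_))) (∑-cong n (f≗g ∘ (2F ∷_))))

∑-+ : ∀ n (f g : Word n 3 → ℕ) → ∑ n (λ w → f w + g w) ≡ ∑ n f + ∑ n g
∑-+ zero    f g = refl
∑-+ (suc n) f g
  rewrite ∑-+ n (f ∘ (0F ∷_)) (g ∘ (0F ∷_))
        | ∑-+ n (f ∘ (1F ∷_)) (g ∘ (1F ∷_))
        | ∑-+ n (f ∘ (2F ∷_)) (g ∘ (2F ∷_)) =
  interchange₃ (∑ n (f ∘ (0F ∷_))) (∑ n (g ∘ (0F ∷_)))
               (∑ n (f ∘ (1F ∷_))) (∑ n (g ∘ (1F ∷_)))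
               (∑ n (f ∘ (2F ∷_))) (∑ n (g ∘ (2F ∷_)))
  where
  interchange₃ : ∀ a b c d e f → (a + b) + ((c + d) + (e + f)) ≡ (a + (c + e)) + (b + (d + f))
  interchange₃ = solve-∀

∑-zero : ∀ n {f : Word n 3 → ℕ} → (∀ w → f w ≡ 0) → ∑ n f ≡ 0
∑-zero zero    z = z []
∑-zero (suc n) z
  rewrite ∑-zero n (z ∘ (0F ∷_)) | ∑-zero n (z ∘ (1F ∷_)) | ∑-zero n (z ∘ (2F ∷_)) = refl

∑-single : ∀ {n} {f : Word n 3 → ℕ} c → (∀ w → w ≢ c → f w ≡ 0) → ∑ n f ≡ f c
∑-single []       z = refl
∑-single {suc n} {f} (0F ∷ c) z
  rewrite ∑-single {f = f ∘ (0F ∷_)} c (λ w w≢c → z _ (w≢c ∘ ∷-injectiveʳ))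
        | ∑-zero n {f ∘ (1F ∷_)} (λ w → z _ λ ())
        | ∑-zero n {f ∘ (2F ∷_)} (λ w → z _ λ ()) = +-identityʳ _
∑-single {suc n} {f} (1F ∷ c) z
  rewrite ∑-single {f = f ∘ (1F ∷_)} c (λ w w≢c → z _ (w≢c ∘ ∷-injectiveʳ))
        | ∑-zero n {f ∘ (0F ∷_)} (λ w → z _ λ ())
        | ∑-zero n {f ∘ (2F ∷_)} (λ w → z _ λ ()) = +-identityʳ _
∑-single {suc n} {f} (2F ∷ c) z
  rewrite ∑-single {f = f ∘ (2F ∷_)} c (λ w w≢c → z _ (w≢c ∘ ∷-injectiveʳ))
        | ∑-zero n {f ∘ (0F ∷_)} (λ w → z _ λ ())
        | ∑-zero n {f ∘ (1F ∷_)} (λ w → z _ λ ()) = refl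

∑-≥ : ∀ {n} (f : Word n 3 → ℕ) w → f w ≤ ∑ n f
∑-≥ f []       = ≤-refl
∑-≥ f (0F ∷ w) = m≤n⇒m≤n+o _ (∑-≥ (f ∘ (0F ∷_)) w)
∑-≥ {suc n} f (1F ∷ w) = m≤n⇒m≤o+n (∑ n (f ∘ (0F ∷_))) (m≤n⇒m≤n+o _ (∑-≥ (f ∘ (1F ∷_)) w))
∑-≥ {suc n} f (2F ∷ w) =
  m≤n⇒m≤o+n (∑ n (f ∘ (0F ∷_))) (m≤n⇒m≤o+n (∑ n (f ∘ (1F ∷_))) (∑-≥ (f ∘ (2F ∷_)) w))

-- From lists of words to recursive sums

module _ {A : Set} where

  sumOver : List A → (A → ℕ) → ℕ
  sumOver xs f = sum (List.map f xs)

  sumOver-++ : ∀ xs ys f → sumOver (xs ++ ys) f ≡ sumOver xs f + sumOver ys f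
  sumOver-++ xs ys f = trans (cong sum (map-++ f xs ys)) (sum-++ (List.map f xs) _)

  sumOver-cong : ∀ xs {f g : A → ℕ} → f ≗ g → sumOver xs f ≡ sumOver xs g
  sumOver-cong xs f≗g = cong sum (map-cong f≗g xs)

  length-filter-sum : ∀ {P : Pred A 0ℓ} (P? : Decidable P) xs →
                      length (filter P? xs) ≡ sumOver xs (bit ∘ does ∘ P?)
  length-filter-sum P? []       = refl
  length-filter-sum P? (x ∷ xs) with does (P? x)
  ... | true  = cong suc (length-filter-sum P? xs)
  ... | false = length-filter-sum P? xs

sumOver-map : ∀ {A B : Set} (h : A → B) xs f → sumOver (List.map h xs) f ≡ sumOver xs (f ∘ h)
sumOver-map h xs f = cong sum (sym (map-∘ xs))

sumOver-cartesianProduct : ∀ {A B : Set} (xs : List A) (ys : List B) f →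
  sumOver (cartesianProduct xs ys) f ≡ sumOver xs λ x → sumOver ys λ y → f (x , y)
sumOver-cartesianProduct []       ys f = refl
sumOver-cartesianProduct (x ∷ xs) ys f =
  trans (sumOver-++ (List.map (x ,_) ys) _ f)
        (cong₂ _+_ (sumOver-map (x ,_) ys f) (sumOver-cartesianProduct xs ys f))

sumOver-words : ∀ n f → sumOver (words n 3) f ≡ ∑ n f
sumOver-words zero    f = +-identityʳ _
sumOver-words (suc n) f =
  trans (sumOver-++ (prefixed 0F) _ f) (cong₂ _+_ (block 0F)
  (trans (sumOver-++ (prefixed 1F) _ f) (cong₂ _+_ (block 1F)
  (trans (sumOver-++ (prefixed 2F) _ f) (trans (cong (_+ 0) (block 2F)) (+-identityʳ _))))))
  where
  prefixed : Fin 3 → List (Word (suc n) 3)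
  prefixed i = List.map (i ∷_) (words n 3)

  block : ∀ i → sumOver (prefixed i) f ≡ ∑ n (f ∘ (i ∷_))
  block i = trans (sumOver-map (i ∷_) (words n 3) f) (sumOver-words n _)

does-≟-true : ∀ b → does (b Bool.≟ true) ≡ b
does-≟-true true  = refl
does-≟-true false = refl

does-≟-false : ∀ b → does (b Bool.≟ false) ≡ not b
does-≟-false true  = refl
does-≟-false false = refl

card boundary : ∀ n → Set[ n ] → ℕ
card     n = FiniteGraph.∣_∣ (Sierpinski n 3)
boundary n = FiniteGraph.∣Θ_∣ (Sierpinski n 3)

card-∑ : ∀ n (S : Set[ n ]) → card n S ≡ ∑ n (bit ∘ S)
card-∑ n S = trans (length-filter-sum (λ v → S v Bool.≟ true) (words n 3))
  (trans (sumOver-words n _) (∑-cong n λ v → cong bit (does-≟-true (S v))))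

∂ : ∀ {n} → Set[ n ] → Word n 3 → Word n 3 → ℕ
∂ S u v = bit (does (joined? u v) ∧ (S u ∧ not (S v)))

boundary-∑ : ∀ n (S : Set[ n ]) → boundary n S ≡ ∑ n λ u → ∑ n λ v → ∂ S u v
boundary-∑ n S = trans (length-filter-sum _ (cartesianProduct (words n 3) (words n 3)))
  (trans (sumOver-cartesianProduct (words n 3) (words n 3) _)
  (trans (sumOver-cong (words n 3) λ u → sumOver-words n _)
  (trans (sumOver-words n _)
  (∑-cong n λ u → ∑-cong n λ v →
    cong (λ b → bit (does (joined? u v) ∧ b)) (cong₂ _∧_ (does-≟-true (S u)) (does-≟-false (S v)))))))

-- Edges within a copy and between two copies

module _ {n : ℕ} {i : Fin 3} {u v : Word n 3} where

  joined-tail : Joined (i ∷ u) (i ∷ v) → Joined u v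
  joined-tail (_   , zero  , _  , i≢i , _)    = contradiction refl i≢i
  joined-tail (u≢v , suc h , eq , neq , swap) =
    u≢v ∘ cong (i ∷_) , h , (λ k k<h → eq (suc k) (s<s k<h)) , neq , λ k h<k → swap (suc k) (s<s h<k)

  joined-∷ : Joined u v → Joined (i ∷ u) (i ∷ v)
  joined-∷ (u≢v , h , eq , neq , swap) = u≢v ∘ ∷-injectiveʳ , suc h , eq′ , neq , swap′
    where
    eq′ : ∀ k → toℕ k < suc (toℕ h) → lookup (i ∷ u) k ≡ lookup (i ∷ v) k
    eq′ zero    _         = refl
    eq′ (suc k) (s<s k<h) = eq k k<h

    swap′ : ∀ k → suc (toℕ h) < toℕ k → _
    swap′ (suc k) (s<s h<k) = swap k h<k

corner : ∀ n → Fin 3 → Word n 3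
corner = replicate

lookup-constant : ∀ {n} (u : Word n 3) j → (∀ k → lookup u k ≡ j) → u ≡ corner n j
lookup-constant []      j eq = refl
lookup-constant (x ∷ u) j eq = cong₂ _∷_ (eq zero) (lookup-constant u j (eq ∘ suc))

module _ {n : ℕ} {i j : Fin 3} (i≢j : i ≢ j) where

  -- The first letters differ, so `h` must be the first position, and the exchange condition then
  -- makes both tails constant.
  joined-across : ∀ {u v : Word n 3} → Joined (i ∷ u) (j ∷ v) → u ≡ corner n j × v ≡ corner n i
  joined-across (_ , zero  , _  , _ , swap) =
    lookup-constant _ j (λ k → proj₁ (swap (suc k) z<s)) ,
    lookup-constant _ i (λ k → proj₂ (swap (suc k) z<s))
  joined-across (_ , suc h , eq , _) = contradiction (eq zero z<s) i≢j

  across-joined : Joined (i ∷ corner n j) (j ∷ corner n i)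
  across-joined = (λ { refl → i≢j refl }) , zero , (λ _ ()) , i≢j ,
    λ { (suc k) _ → lookup-replicate k j , lookup-replicate k i }

  -- A single edge connects the two copies, so only one term of the double sum survives.
  ∂-across : ∀ (S : Set[ suc n ]) →
    (∑ n λ u → ∑ n λ v → ∂ S (i ∷ u) (j ∷ v)) ≡ bit (S (i ∷ corner n j) ∧ not (S (j ∷ corner n i)))
  ∂-across S =
    trans (∑-single (corner n j) λ u u≢ → ∑-zero n λ v → vanish u v (u≢ ∘ proj₁))
    (trans (∑-single (corner n i) λ v v≢ → vanish _ v (v≢ ∘ proj₂))
    (cong (λ b → bit (b ∧ (S (i ∷ corner n j) ∧ not (S (j ∷ corner n i)))))
      (dec-true (joined? _ _) across-joined)))
    where
    vanish : ∀ u v → ¬ (u ≡ corner n j × v ≡ corner n i) → ∂ S (i ∷ u) (j ∷ v) ≡ 0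
    vanish u v ¬corner =
      cong (λ b → bit (b ∧ (S (i ∷ u) ∧ not (S (j ∷ v)))))
        (dec-false (joined? (i ∷ u) (j ∷ v)) (¬corner ∘ joined-across))

∂-within : ∀ {n} i (S : Set[ suc n ]) u v → ∂ S (i ∷ u) (i ∷ v) ≡ ∂ (S ∘ (i ∷_)) u v
∂-within i S u v = cong (λ b → bit (b ∧ (S (i ∷ u) ∧ not (S (i ∷ v)))))
  (does-⇔ (mk⇔ joined-tail joined-∷) (joined? (i ∷ u) (i ∷ v)) (joined? u v))


-- `∂` is directed from S outwards, so an undirected edge collects the terms of both its
-- orientations.
cut : Bool → Bool → ℕ
cut x y = bit (x ∧ not y) + bit (y ∧ not x)

-- The weight `e` is a parameter because the three joining edges are counted in two ways: with `cut`
-- those leaving S, with `bond` those inside S.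
across : ∀ {n} → (Bool → Bool → ℕ) → Set[ suc n ] → ℕ
across {n} e S =
  edge 0F 1F + (edge 0F 2F + edge 1F 2F)
  where
  edge : Fin 3 → Fin 3 → ℕ
  edge i j = e (S (i ∷ corner n j)) (S (j ∷ corner n i))

θ : ∀ n → Set[ n ] → ℕ
θ zero    S = 0
θ (suc n) S = (θ n (S ∘ (0F ∷_)) + (θ n (S ∘ (1F ∷_)) + θ n (S ∘ (2F ∷_)))) + across cut S

∑-+₃ : ∀ n (f g h : Word n 3 → ℕ) → ∑ n (λ w → f w + (g w + h w)) ≡ ∑ n f + (∑ n g + ∑ n h)
∑-+₃ n f g h = trans (∑-+ n f _) (cong (∑ n f +_) (∑-+ n g h))

∑∂≡θ : ∀ n (S : Set[ n ]) → (∑ n λ u → ∑ n λ v → ∂ S u v) ≡ θ n S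
∑∂≡θ zero    S with S []
... | true  = refl
... | false = refl
∑∂≡θ (suc n) S = trans
  (cong₂ _+_ (trans (row 0F) (cong₂ _+_ (within 0F) (cong₂ _+_ (∂-across (λ ()) S) (∂-across (λ ()) S))))
  (cong₂ _+_ (trans (row 1F) (cong₂ _+_ (∂-across (λ ()) S) (cong₂ _+_ (within 1F) (∂-across (λ ()) S))))
             (trans (row 2F) (cong₂ _+_ (∂-across (λ ()) S) (cong₂ _+_ (∂-across (λ ()) S) (within 2F))))))
  (regroup (θ n (S ∘ (0F ∷_))) (θ n (S ∘ (1F ∷_))) (θ n (S ∘ (2F ∷_)))
      (b 0F 1F) (b 1F 0F) (b 0F 2F) (b 2F 0F) (b 1F 2F) (b 2F 1F))
  where
  row : ∀ i → (∑ n λ u → ∑ (suc n) λ v → ∂ S (i ∷ u) v) ≡ _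
  row i = ∑-+₃ n (λ u → ∑ n λ v → ∂ S (i ∷ u) (0F ∷ v))
                 (λ u → ∑ n λ v → ∂ S (i ∷ u) (1F ∷ v))
                 (λ u → ∑ n λ v → ∂ S (i ∷ u) (2F ∷ v))

  within : ∀ i → (∑ n λ u → ∑ n λ v → ∂ S (i ∷ u) (i ∷ v)) ≡ θ n (S ∘ (i ∷_))
  within i = trans (∑-cong n λ u → ∑-cong n λ v → ∂-within i S u v) (∑∂≡θ n (S ∘ (i ∷_)))

  b : Fin 3 → Fin 3 → ℕ
  b i j = bit (S (i ∷ corner n j) ∧ not (S (j ∷ corner n i)))

  regroup : ∀ t₀ t₁ t₂ b₀₁ b₁₀ b₀₂ b₂₀ b₁₂ b₂₁ →
    (t₀ + (b₀₁ + b₀₂)) + ((b₁₀ + (t₁ + b₁₂)) + (b₂₀ + (b₂₁ + t₂)))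
      ≡ (t₀ + (t₁ + t₂)) + ((b₀₁ + b₁₀) + ((b₀₂ + b₂₀) + (b₁₂ + b₂₁)))
  regroup = solve-∀

boundary≡θ : ∀ n (S : Set[ n ]) → boundary n S ≡ θ n S
boundary≡θ n S = trans (boundary-∑ n S) (∑∂≡θ n S)

-- `Φ` and its recursion

size : ∀ n → Set[ n ] → ℕ
size n S = ∑ n (bit ∘ S)

-- For `n` = 0 the three corners coincide and the only vertex counts three times, as if it carried
-- three pendant edges; with this convention `Φ-suc` holds from the bottom level on.
corners : ∀ n → Set[ n ] → ℕ
corners n S = bit (S (corner n 0F)) + (bit (S (corner n 1F)) + bit (S (corner n 2F)))

Φ : ∀ n → Set[ n ] → ℕ
Φ n S = θ n S + corners n S

bond : Bool → Bool → ℕ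
bond x y = bit (x ∧ y)

-- An edge between two copies is pendant in both of them, so it is counted twice on the right
-- when it lies inside S, and correctly otherwise.
Φ-suc : ∀ n S → Φ (suc n) S + 2 * across bond S
              ≡ Φ n (S ∘ (0F ∷_)) + (Φ n (S ∘ (1F ∷_)) + Φ n (S ∘ (2F ∷_)))
Φ-suc n S = regroup
    (θ n (S ∘ (0F ∷_))) (θ n (S ∘ (1F ∷_))) (θ n (S ∘ (2F ∷_)))
    (p 0F 0F) (p 1F 1F) (p 2F 2F) (p 0F 1F) (p 1F 0F) (p 0F 2F) (p 2F 0F) (p 1F 2F) (p 2F 1F)
    (c 0F 1F) (e 0F 1F) (c 0F 2F) (e 0F 2F) (c 1F 2F) (e 1F 2F)
    (cut-bond (s 0F 1F) (s 1F 0F)) (cut-bond (s 0F 2F) (s 2F 0F)) (cut-bond (s 1F 2F) (s 2F 1F))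
  where
  s : Fin 3 → Fin 3 → Bool
  s i j = S (i ∷ corner n j)

  p c e : Fin 3 → Fin 3 → ℕ
  p i j = bit (s i j)
  c i j = cut  (s i j) (s j i)
  e i j = bond (s i j) (s j i)

  cut-bond : ∀ x y → cut x y + 2 * bond x y ≡ bit x + bit y
  cut-bond true  true  = refl
  cut-bond true  false = refl
  cut-bond false true  = refl
  cut-bond false false = refl

  regroup : ∀ t₀ t₁ t₂ p₀₀ p₁₁ p₂₂ p₀₁ p₁₀ p₀₂ p₂₀ p₁₂ p₂₁ c₀₁ e₀₁ c₀₂ e₀₂ c₁₂ e₁₂ →
    c₀₁ + 2 * e₀₁ ≡ p₀₁ + p₁₀ → c₀₂ + 2 * e₀₂ ≡ p₀₂ + p₂₀ → c₁₂ + 2 * e₁₂ ≡ p₁₂ + p₂₁ →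
    (((t₀ + (t₁ + t₂)) + (c₀₁ + (c₀₂ + c₁₂))) + (p₀₀ + (p₁₁ + p₂₂))) + 2 * (e₀₁ + (e₀₂ + e₁₂))
      ≡ (t₀ + (p₀₀ + (p₀₁ + p₀₂))) + ((t₁ + (p₁₀ + (p₁₁ + p₁₂))) + (t₂ + (p₂₀ + (p₂₁ + p₂₂))))
  regroup t₀ t₁ t₂ p₀₀ p₁₁ p₂₂ p₀₁ p₁₀ p₀₂ p₂₀ p₁₂ p₂₁ c₀₁ e₀₁ c₀₂ e₀₂ c₁₂ e₁₂ eq₀₁ eq₀₂ eq₁₂ =
    trans (pair t₀ t₁ t₂ p₀₀ p₁₁ p₂₂ c₀₁ e₀₁ c₀₂ e₀₂ c₁₂ e₁₂)
    (trans (cong ((t₀ + (t₁ + t₂)) + (p₀₀ + (p₁₁ + p₂₂)) +_) (cong₂ _+_ eq₀₁ (cong₂ _+_ eq₀₂ eq₁₂)))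
    (unpair t₀ t₁ t₂ p₀₀ p₁₁ p₂₂ p₀₁ p₁₀ p₀₂ p₂₀ p₁₂ p₂₁))
    where
    pair : ∀ t₀ t₁ t₂ p₀₀ p₁₁ p₂₂ c₀₁ e₀₁ c₀₂ e₀₂ c₁₂ e₁₂ →
      (((t₀ + (t₁ + t₂)) + (c₀₁ + (c₀₂ + c₁₂))) + (p₀₀ + (p₁₁ + p₂₂))) + 2 * (e₀₁ + (e₀₂ + e₁₂))
        ≡ (t₀ + (t₁ + t₂)) + (p₀₀ + (p₁₁ + p₂₂))
            + ((c₀₁ + 2 * e₀₁) + ((c₀₂ + 2 * e₀₂) + (c₁₂ + 2 * e₁₂)))
    pair = solve-∀

    unpair : ∀ t₀ t₁ t₂ p₀₀ p₁₁ p₂₂ p₀₁ p₁₀ p₀₂ p₂₀ p₁₂ p₂₁ →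
      (t₀ + (t₁ + t₂)) + (p₀₀ + (p₁₁ + p₂₂)) + ((p₀₁ + p₁₀) + ((p₀₂ + p₂₀) + (p₁₂ + p₂₁)))
        ≡ (t₀ + (p₀₀ + (p₀₁ + p₀₂))) + ((t₁ + (p₁₀ + (p₁₁ + p₁₂))) + (t₂ + (p₂₀ + (p₂₁ + p₂₂))))
    unpair = solve-∀

across-cong : ∀ {n} e {S T : Set[ suc n ]} → S ≗ T → across e S ≡ across e T
across-cong e S≗T =
  cong₂ _+_ (cong₂ e (S≗T _) (S≗T _))
    (cong₂ _+_ (cong₂ e (S≗T _) (S≗T _)) (cong₂ e (S≗T _) (S≗T _)))

θ-cong : ∀ n {S T : Set[ n ]} → S ≗ T → θ n S ≡ θ n T
θ-cong zero    S≗T = refl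
θ-cong (suc n) {S} {T} S≗T = cong₂ _+_
  (cong₂ _+_ (θ-cong n (S≗T ∘ (0F ∷_))) (cong₂ _+_ (θ-cong n (S≗T ∘ (1F ∷_))) (θ-cong n (S≗T ∘ (2F ∷_)))))
  (across-cong cut {S} {T} S≗T)

Φ-cong : ∀ n {S T : Set[ n ]} → S ≗ T → Φ n S ≡ Φ n T
Φ-cong n S≗T = cong₂ _+_ (θ-cong n S≗T)
  (cong₂ _+_ (cong bit (S≗T _)) (cong₂ _+_ (cong bit (S≗T _)) (cong bit (S≗T _))))

-- Complements

cut-not : ∀ x y → cut (not x) (not y) ≡ cut x y
cut-not true  true  = refl
cut-not true  false = refl
cut-not false true  = refl
cut-not false false = refl

θ-∁ : ∀ n (S : Set[ n ]) → θ n (not ∘ S) ≡ θ n S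
θ-∁ zero    S = refl
θ-∁ (suc n) S = cong₂ _+_
  (cong₂ _+_ (θ-∁ n _) (cong₂ _+_ (θ-∁ n _) (θ-∁ n _)))
  (cong₂ _+_ (cut-not (S _) (S _)) (cong₂ _+_ (cut-not (S _) (S _)) (cut-not (S _) (S _))))

corners-∁ : ∀ n (S : Set[ n ]) → corners n (not ∘ S) + corners n S ≡ 3
corners-∁ n S with S (corner n 0F) | S (corner n 1F) | S (corner n 2F)
... | true  | true  | true  = refl
... | true  | true  | false = refl
... | true  | false | true  = refl
... | true  | false | false = refl
... | false | true  | true  = refl
... | false | true  | false = refl
... | false | false | true  = refl
... | false | false | false = refl

∑-one : ∀ n {f : Word n 3 → ℕ} → (∀ w → f w ≡ 1) → ∑ n f ≡ 3 ^ n
∑-one zero    o = o []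
∑-one (suc n) o
  rewrite ∑-one n (o ∘ (0F ∷_)) | ∑-one n (o ∘ (1F ∷_)) | ∑-one n (o ∘ (2F ∷_))
        | +-identityʳ (3 ^ n) = refl

size-∁ : ∀ n (S : Set[ n ]) → size n (not ∘ S) + size n S ≡ 3 ^ n
size-∁ n S = trans (sym (∑-+ n (bit ∘ not ∘ S) (bit ∘ S))) (∑-one n (λ w → bit-not (S w)))
  where
  bit-not : ∀ b → bit (not b) + bit b ≡ 1
  bit-not true  = refl
  bit-not false = refl

-- Complementation preserves the edge boundary and turns c corners into 3 - c; the additive form
-- avoids truncated subtraction.
Φ-∁ : ∀ n (S : Set[ n ]) → Φ n (not ∘ S) + 2 * corners n S ≡ Φ n S + 3
Φ-∁ n S = trans (regroup (θ n (not ∘ S)) _ (corners n S)) (cong₂ (λ t c → t + corners n S + c) (θ-∁ n S) (corners-∁ n S))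
  where
  regroup : ∀ t c′ c → (t + c′) + 2 * c ≡ (t + c) + (c′ + c)
  regroup = solve-∀

-- Initial segments

opaque
  -- Opaque, so that conversion checking does not unfold the comparison; the lemmas of this block
  -- are its interface.
  seg : ∀ n → ℕ → Set[ n ]
  seg n ℓ w = does (Lex w ≤? ℓ)

  Lex⁻¹≗seg : ∀ {n} ℓ → Lex⁻¹[1⋯ ℓ ] ≗ seg n ℓ
  -- `Lex w` is a successor, so the test `1 ≤? Lex w` evaluates to `true` and both sides compute to
  -- the comparison with `ℓ`.
  Lex⁻¹≗seg ℓ w = isYes≗does _

  seg-true : ∀ {n} ℓ (w : Word n 3) → Lex w ≤ ℓ → seg n ℓ w ≡ true
  seg-true ℓ w = dec-true (Lex w ≤? ℓ)

  seg-false : ∀ {n} ℓ (w : Word n 3) → ℓ < Lex w → seg n ℓ w ≡ false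
  seg-false ℓ w ℓ<L = dec-false (Lex w ≤? ℓ) (<⇒≱ ℓ<L)

  seg-⇔ : ∀ {m n k ℓ} (v : Word m 3) (w : Word n 3) →
          (Lex v ≤ k → Lex w ≤ ℓ) → (Lex w ≤ ℓ → Lex v ≤ k) → seg m k v ≡ seg n ℓ w
  seg-⇔ v w to from = does-⇔ (mk⇔ to from) (Lex v ≤? _) (Lex w ≤? _)

seg-empty : ∀ {n} (w : Word n 3) → seg n 0 w ≡ false
seg-empty w = seg-false 0 w z<s

-- In the names of hypotheses below, M stands for 3 ^ n and H for half n.
half : ℕ → ℕ
half zero    = 0
half (suc n) = 3 ^ n + half n

-- `half n` is the number of words before the corner 1...1, which is therefore the middle word of
-- the lexicographic order.
3^n-odd : ∀ n → 3 ^ n ≡ suc (half n + half n)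
3^n-odd zero    = refl
3^n-odd (suc n) = trans (cong (λ x → 3 ^ n + (3 ^ n + (x + 0))) (3^n-odd n)) (regroup (3 ^ n) (half n))
  where
  regroup : ∀ M H → M + (M + (suc (H + H) + 0)) ≡ suc ((M + H) + (M + H))
  regroup = solve-∀

half<3^n : ∀ n → half n < 3 ^ n
half<3^n n = subst (suc (half n) ≤_) (sym (3^n-odd n)) (s≤s (m≤m+n _ _))

1≤3^n : ∀ n → 1 ≤ 3 ^ n
1≤3^n n = m^n>0 3 n

Lex-∷ : ∀ {n} i (w : Word n 3) → Lex (i ∷ w) ≡ toℕ i * 3 ^ n + Lex w
Lex-∷ i w = sym (+-suc _ _)

Lex-≤ : ∀ {n} (w : Word n 3) → Lex w ≤ 3 ^ n
Lex-≤         []      = ≤-refl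
Lex-≤ {suc n} (i ∷ w) = begin
  Lex (i ∷ w)          ≡⟨ Lex-∷ i w ⟩
  toℕ i * 3 ^ n + Lex w ≤⟨ +-mono-≤ (*-monoˡ-≤ (3 ^ n) (Fin.toℕ≤pred[n] i)) (Lex-≤ w) ⟩
  2 * 3 ^ n + 3 ^ n     ≡⟨ +-comm (2 * 3 ^ n) (3 ^ n) ⟩
  3 * 3 ^ n             ∎
  where open ≤-Reasoning

Lex-corner₀ : ∀ n → Lex (corner n 0F) ≡ 1
Lex-corner₀ zero    = refl
Lex-corner₀ (suc n) = trans (Lex-∷ 0F (corner n 0F)) (Lex-corner₀ n)

Lex-corner₁ : ∀ n → Lex (corner n 1F) ≡ suc (half n)
Lex-corner₁ zero    = refl
Lex-corner₁ (suc n) = trans (Lex-∷ 1F (corner n 1F))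
  (trans (cong₂ _+_ (*-identityˡ (3 ^ n)) (Lex-corner₁ n)) (+-suc _ _))

Lex-corner₂ : ∀ n → Lex (corner n 2F) ≡ 3 ^ n
Lex-corner₂ zero    = refl
Lex-corner₂ (suc n) = trans (Lex-∷ 2F (corner n 2F))
  (trans (cong (2 * 3 ^ n +_) (Lex-corner₂ n)) (+-comm (2 * 3 ^ n) (3 ^ n)))

seg-full : ∀ {n} (w : Word n 3) → seg n (3 ^ n) w ≡ true
seg-full {n} w = seg-true (3 ^ n) w (Lex-≤ w)

module _ {n : ℕ} where

  seg-corner₀ : ∀ {ℓ} → 1 ≤ ℓ → seg n ℓ (corner n 0F) ≡ true
  seg-corner₀ {ℓ} 1≤ℓ = seg-true ℓ _ (subst (_≤ ℓ) (sym (Lex-corner₀ n)) 1≤ℓ)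

  seg-corner₁-false : ∀ {ℓ} → ℓ ≤ half n → seg n ℓ (corner n 1F) ≡ false
  seg-corner₁-false {ℓ} ℓ≤H = seg-false ℓ _ (subst (ℓ <_) (sym (Lex-corner₁ n)) (s≤s ℓ≤H))

  seg-corner₁-true : ∀ {ℓ} → half n < ℓ → seg n ℓ (corner n 1F) ≡ true
  seg-corner₁-true {ℓ} H<ℓ = seg-true ℓ _ (subst (_≤ ℓ) (sym (Lex-corner₁ n)) H<ℓ)

  seg-corner₂-false : ∀ {ℓ} → ℓ < 3 ^ n → seg n ℓ (corner n 2F) ≡ false
  seg-corner₂-false {ℓ} ℓ<M = seg-false ℓ _ (subst (ℓ <_) (sym (Lex-corner₂ n)) ℓ<M)

  seg-∷ : ∀ i r w → seg (suc n) (toℕ i * 3 ^ n + r) (i ∷ w) ≡ seg n r w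
  seg-∷ i r w = seg-⇔ (i ∷ w) w
    (λ p → +-cancelˡ-≤ (toℕ i * 3 ^ n) (Lex w) r (subst (_≤ toℕ i * 3 ^ n + r) (Lex-∷ i w) p))
    (λ p → subst (_≤ toℕ i * 3 ^ n + r) (sym (Lex-∷ i w)) (+-monoʳ-≤ (toℕ i * 3 ^ n) p))

  seg-∷-full : ∀ i ℓ w → toℕ i * 3 ^ n + 3 ^ n ≤ ℓ → seg (suc n) ℓ (i ∷ w) ≡ seg n (3 ^ n) w
  seg-∷-full i ℓ w p = trans
    (seg-true ℓ (i ∷ w) (≤-trans (≤-reflexive (Lex-∷ i w)) (≤-trans (+-monoʳ-≤ (toℕ i * 3 ^ n) (Lex-≤ w)) p)))
    (sym (seg-full w))

  seg-∷-empty : ∀ i ℓ w → ℓ ≤ toℕ i * 3 ^ n → seg (suc n) ℓ (i ∷ w) ≡ seg n 0 w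
  seg-∷-empty i ℓ w p = trans
    (seg-false ℓ (i ∷ w) (subst (ℓ <_) (sym (Lex-∷ i w)) (≤-trans (s≤s p) (m<m+n (toℕ i * 3 ^ n) z<s))))
    (sym (seg-empty w))

-- The traces of an initial segment on the copies are again initial segments. Being a relation, this
-- lets each range of `ℓ` supply its three lengths directly.
record Blocks (n ℓ a₀ a₁ a₂ : ℕ) : Set where
  field
    block₀ : seg (suc n) ℓ ∘ (0F ∷_) ≗ seg n a₀
    block₁ : seg (suc n) ℓ ∘ (1F ∷_) ≗ seg n a₁
    block₂ : seg (suc n) ℓ ∘ (2F ∷_) ≗ seg n a₂

first-blocks : ∀ {n ℓ} → ℓ ≤ 3 ^ n → Blocks n ℓ ℓ 0 0
first-blocks {n} {ℓ} ℓ≤M = record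
  { block₀ = seg-∷ 0F ℓ
  ; block₁ = λ w → seg-∷-empty 1F _ w (≤-trans ℓ≤M (m≤m+n _ _))
  ; block₂ = λ w → seg-∷-empty 2F _ w (≤-trans ℓ≤M (m≤m+n _ _))
  }

second-blocks : ∀ {n r} → r ≤ 3 ^ n → Blocks n (3 ^ n + r) (3 ^ n) r 0
second-blocks {n} {r} r≤M = record
  { block₀ = λ w → seg-∷-full 0F _ w (m≤m+n _ _)
  ; block₁ = λ w → trans (cong (λ x → seg (suc n) (x + r) (1F ∷ w)) (sym (*-identityˡ (3 ^ n)))) (seg-∷ 1F r w)
  ; block₂ = λ w → seg-∷-empty 2F _ w (+-monoʳ-≤ (3 ^ n) (≤-trans r≤M (m≤m+n _ _)))
  }

third-blocks : ∀ {n r} → Blocks n (3 ^ n + (3 ^ n + r)) (3 ^ n) (3 ^ n) r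
third-blocks {n} {r} = record
  { block₀ = λ w → seg-∷-full 0F _ w (m≤m+n _ _)
  ; block₁ = λ w → seg-∷-full 1F _ w (≤-trans (≤-reflexive (one+ (3 ^ n))) (+-monoʳ-≤ (3 ^ n) (m≤m+n (3 ^ n) r)))
  ; block₂ = λ w → trans (cong (λ x → seg (suc n) x (2F ∷ w)) (two+ (3 ^ n) r)) (seg-∷ 2F r w)
  }
  where
  one+ : ∀ M → 1 * M + M ≡ M + M
  one+ = solve-∀
  two+ : ∀ M r → M + (M + r) ≡ 2 * M + r
  two+ = solve-∀

-- The values of `Φ` on initial segments

opaque
  φ : ℕ → ℕ → ℕ
  φ n ℓ = Φ n (seg n ℓ)

  φ≡Φ-seg : ∀ n ℓ → φ n ℓ ≡ Φ n (seg n ℓ)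
  φ≡Φ-seg n ℓ = refl

module _ {n ℓ a₀ a₁ a₂} (blocks : Blocks n ℓ a₀ a₁ a₂) where
  open Blocks blocks

  size-blocks : size (suc n) (seg (suc n) ℓ) ≡ size n (seg n a₀) + (size n (seg n a₁) + size n (seg n a₂))
  size-blocks = cong₂ _+_ (∑-cong n (cong bit ∘ block₀))
    (cong₂ _+_ (∑-cong n (cong bit ∘ block₁)) (∑-cong n (cong bit ∘ block₂)))

  bonds : ℕ
  bonds = bond (seg n a₀ (corner n 1F)) (seg n a₁ (corner n 0F))
        + (bond (seg n a₀ (corner n 2F)) (seg n a₂ (corner n 0F))
         + bond (seg n a₁ (corner n 2F)) (seg n a₂ (corner n 1F)))

  opaque
    unfolding φ

    φ-blocks : φ (suc n) ℓ + 2 * bonds ≡ φ n a₀ + (φ n a₁ + φ n a₂)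
    φ-blocks =
      trans (cong (λ e → φ (suc n) ℓ + 2 * e) (sym (cong₂ _+_ (cong₂ bond (block₀ _) (block₁ _))
              (cong₂ _+_ (cong₂ bond (block₀ _) (block₂ _)) (cong₂ bond (block₁ _) (block₂ _))))))
      (trans (Φ-suc n (seg (suc n) ℓ))
      (cong₂ _+_ (Φ-cong n block₀) (cong₂ _+_ (Φ-cong n block₁) (Φ-cong n block₂))))

  φ-blocks′ : ∀ {e} → bonds ≡ e → φ (suc n) ℓ + 2 * e ≡ φ n a₀ + (φ n a₁ + φ n a₂)
  φ-blocks′ refl = φ-blocks

bond-falseʳ : ∀ x {y} → y ≡ false → bond x y ≡ 0
bond-falseʳ x refl = cong bit (Bool.∧-zeroʳ x)

-- What two full copies add to the third one: 6 from their pendant edges, minus 4 for the two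
-- joining edges that are inside at once, and minus 2 more when the segment reaches corner 1...1 of
-- the third copy, past `half n`.
gap : ℕ → ℕ → ℕ
gap n r = if does (r ≤? half n) then 2 else 0

-- Segments fill the copies in order; a full copy contributes 3 and each joining edge inside the
-- segment takes off 2. The equations are proved by a joint induction.
φ-zero   : ∀ n → φ n 0 ≡ 0
φ-first  : ∀ {n ℓ} → ℓ ≤ 3 ^ n → φ (suc n) ℓ ≡ φ n ℓ
φ-full   : ∀ n → φ n (3 ^ n) ≡ 3
φ-second : ∀ {n r} → 1 ≤ r → r ≤ 3 ^ n → φ (suc n) (3 ^ n + r) ≡ 1 + φ n r
φ-third  : ∀ {n r} → 1 ≤ r → r ≤ 3 ^ n → φ (suc n) (3 ^ n + (3 ^ n + r)) ≡ gap n r + φ n r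

gap-≤ : ∀ {n r} → r ≤ half n → gap n r ≡ 2
gap-≤ {n} {r} r≤H = cong (if_then 2 else 0) (dec-true (r ≤? half n) r≤H)

gap-> : ∀ {n r} → half n < r → gap n r ≡ 0
gap-> {n} {r} H<r = cong (if_then 2 else 0) (dec-false (r ≤? half n) (<⇒≱ H<r))

φ-zero zero    = trans (φ≡Φ-seg 0 0) (cong (λ b → bit b + (bit b + bit b)) (seg-empty []))
φ-zero (suc n) = trans (φ-first {n} z≤n) (φ-zero n)

φ-first {n} {ℓ} ℓ≤M = trans (sym (+-identityʳ _)) (trans (φ-blocks′ (first-blocks ℓ≤M) no-bonds)
  (trans (cong (φ n ℓ +_) (cong₂ _+_ (φ-zero n) (φ-zero n))) (+-identityʳ _)))
  where
  no-bonds : bonds (first-blocks ℓ≤M) ≡ 0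
  no-bonds = cong₂ _+_ (bond-falseʳ (seg n ℓ (corner n 1F)) (seg-empty (corner n 0F)))
    (cong₂ _+_ (bond-falseʳ (seg n ℓ (corner n 2F)) (seg-empty (corner n 0F)))
               (bond-falseʳ (seg n 0 (corner n 2F)) (seg-empty (corner n 1F))))

φ-full zero    = trans (φ≡Φ-seg 0 1) (cong (λ b → bit b + (bit b + bit b)) (seg-full []))
φ-full (suc n) = begin
  φ (suc n) (3 ^ suc n)                   ≡⟨ cong (λ x → φ (suc n) (3 ^ n + (3 ^ n + x))) (+-identityʳ (3 ^ n)) ⟩
  φ (suc n) (3 ^ n + (3 ^ n + 3 ^ n))     ≡⟨ φ-third (1≤3^n n) ≤-refl ⟩
  gap n (3 ^ n) + φ n (3 ^ n)             ≡⟨ cong₂ _+_ (gap-> {n} (half<3^n n)) (φ-full n) ⟩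
  3                                       ∎
  where open ≡-Reasoning

φ-second {n} {r} 1≤r r≤M = +-cancelʳ-≡ 2 _ _ (trans (φ-blocks′ (second-blocks r≤M) one-bond)
  (trans (cong₂ (λ x y → x + (φ n r + y)) (φ-full n) (φ-zero n)) (regroup (φ n r))))
  where
  one-bond : bonds (second-blocks r≤M) ≡ 1
  one-bond = cong₂ _+_ (cong₂ bond (seg-full (corner n _)) (seg-corner₀ 1≤r))
    (cong₂ _+_ (bond-falseʳ (seg n (3 ^ n) (corner n 2F)) (seg-empty (corner n 0F)))
               (bond-falseʳ (seg n r (corner n 2F)) (seg-empty (corner n 1F))))

  regroup : ∀ x → 3 + (x + 0) ≡ (1 + x) + 2
  regroup = solve-∀

φ-third {n} {r} 1≤r r≤M = cancel (φ n r) (bit b₁) gap-bit (trans (φ-blocks′ third-blocks bonds≥2)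
  (cong₂ (λ x y → x + (y + φ n r)) (φ-full n) (φ-full n)))
  where
  b₁ : Bool
  b₁ = seg n r (corner n 1F)

  bonds≥2 : bonds (third-blocks {n} {r}) ≡ 2 + bit b₁
  bonds≥2 = cong₂ _+_ (cong₂ bond (seg-full (corner n _)) (seg-full (corner n _)))
    (cong₂ _+_ (cong₂ bond (seg-full (corner n _)) (seg-corner₀ 1≤r))
               (cong (λ x → bond x b₁) (seg-full (corner n _))))

  gap-bit : gap n r + 2 * bit b₁ ≡ 2
  gap-bit with ≤-<-connex r (half n)
  ... | inj₁ r≤H = cong₂ (λ g b → g + 2 * bit b) (gap-≤ {n} r≤H) (seg-corner₁-false {n} r≤H)
  ... | inj₂ H<r = cong₂ (λ g b → g + 2 * bit b) (gap-> {n} H<r) (seg-corner₁-true {n} H<r)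

  cancel : ∀ {x g} y b → g + 2 * b ≡ 2 → x + 2 * (2 + b) ≡ 3 + (3 + y) → x ≡ g + y
  cancel {x} {g} y b g+2b≡2 eq = +-cancelʳ-≡ (4 + 2 * b) _ _
    (trans (left x b) (trans eq (trans (cong (λ z → 4 + (z + y)) (sym g+2b≡2)) (right g y b))))
    where
    left : ∀ x b → x + (4 + 2 * b) ≡ x + 2 * (2 + b)
    left = solve-∀
    right : ∀ g y b → 4 + ((g + 2 * b) + y) ≡ (g + y) + (4 + 2 * b)
    right = solve-∀

-- A segment ending exactly with a copy belongs to the earlier range, so that the remainder `r` is
-- positive, as `φ-second` and `φ-third` require.
data Position (n ℓ : ℕ) : Set where
  first  : ℓ ≤ 3 ^ n → Position n ℓ
  second : ∀ r → 1 ≤ r → r ≤ 3 ^ n → ℓ ≡ 3 ^ n + r → Position n ℓ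
  third  : ∀ r → 1 ≤ r → r ≤ 3 ^ n → ℓ ≡ 3 ^ n + (3 ^ n + r) → Position n ℓ

excess : ∀ {m ℓ} → m < ℓ → ∃[ r ] (1 ≤ r × ℓ ≡ m + r)
excess m<ℓ with m≤n⇒∃[o]m+o≡n m<ℓ
... | r , refl = suc r , z<s , sym (+-suc _ r)

third-bound : ∀ n {x} → 3 ^ n + (3 ^ n + x) ≤ 3 ^ suc n → x ≤ 3 ^ n
third-bound n p = ≤-trans (+-cancelˡ-≤ (3 ^ n) _ _ (+-cancelˡ-≤ (3 ^ n) _ _ p))
  (≤-reflexive (+-identityʳ (3 ^ n)))

position : ∀ n {ℓ} → ℓ ≤ 3 ^ suc n → Position n ℓ
position n {ℓ} ℓ≤ with ℓ ≤? 3 ^ n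
... | yes ℓ≤M = first ℓ≤M
... | no  ℓ≰M with excess (≰⇒> ℓ≰M)
... | r , 1≤r , refl with r ≤? 3 ^ n
... | yes r≤M = second r 1≤r r≤M refl
... | no  r≰M with excess (≰⇒> r≰M)
... | s , 1≤s , refl = third s 1≤s (third-bound n ℓ≤) refl

size-seg : ∀ n {ℓ} → ℓ ≤ 3 ^ n → size n (seg n ℓ) ≡ ℓ
size-seg zero {zero}        _ = cong bit (seg-empty [])
size-seg zero {suc zero}    _ = cong bit (seg-full [])
size-seg zero {suc (suc _)} (s≤s ())
size-seg (suc n) ℓ≤ with position n ℓ≤
... | first ℓ≤M = trans (size-blocks (first-blocks {n} ℓ≤M))
  (trans (cong₂ _+_ (size-seg n ℓ≤M) (cong₂ _+_ (size-seg n z≤n) (size-seg n z≤n))) (+-identityʳ _))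
... | second r _ r≤M refl = trans (size-blocks (second-blocks {n} r≤M))
  (cong₂ _+_ (size-seg n ≤-refl) (trans (cong₂ _+_ (size-seg n r≤M) (size-seg n z≤n)) (+-identityʳ r)))
... | third r _ r≤M refl = trans (size-blocks (third-blocks {n} {r}))
  (cong₂ _+_ (size-seg n ≤-refl) (cong₂ _+_ (size-seg n ≤-refl) (size-seg n r≤M)))

-- Both sides of L ≤ R are added crosswise, so that a linear inequality becomes one semiring
-- identity with slack d.
≤-by : ∀ d {L R p q} → L ≤ R → p + R + d ≡ q + L → p ≤ q
≤-by d {L} {R} {p} {q} L≤R eq = +-cancelʳ-≤ L p q
  (≤-trans (+-monoʳ-≤ p L≤R) (≤-trans (m≤m+n (p + R) d) (≤-reflexive eq)))

-- Reflection in the middle of the order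

module _ {n a b : ℕ} (a+b≡M : a + b ≡ 3 ^ n) where

  ≤half⇒half< : a ≤ half n → half n < b
  ≤half⇒half< a≤H = ≰⇒> λ b≤H → <⇒≱ (≤-reflexive (sym (3^n-odd n)))
    (≤-trans (≤-reflexive (sym a+b≡M)) (+-mono-≤ a≤H b≤H))

  half<⇒≤half : half n < a → b ≤ half n
  half<⇒≤half H<a = ≮⇒≥ λ H<b → <⇒≱ (≤-trans (≤-reflexive (cong suc (3^n-odd n)))
      (≤-trans (≤-reflexive (cong suc (sym (+-suc (half n) (half n))))) (+-mono-≤ H<a H<b)))
    (≤-reflexive a+b≡M)

-- Reversing the alphabet carries the complement of the segment of length `a` to the segment of
-- length `b`: the boundaries agree, but the first segment holds one corner and the second two. The
-- proof verifies this on the recursion for `φ`, where reflection exchanges the outer copies.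
φ-reflect : ∀ n {a b} → 1 ≤ a → a ≤ half n → a + b ≡ 3 ^ n → φ n b ≡ 1 + φ n a
φ-reflect zero    1≤a a≤H _ = contradiction (≤-trans 1≤a a≤H) λ ()
φ-reflect (suc n) {a} {b} 1≤a a≤H eq with position n (≤-trans (m≤m+n a b) (≤-reflexive eq))
... | third r _ _ refl = contradiction (+-cancelˡ-≤ (3 ^ n) _ _ a≤H)
        (<⇒≱ (≤-trans (half<3^n n) (m≤m+n (3 ^ n) r)))
-- The middle copy is reflected to itself, so the induction hypothesis applies to the remainders.
... | second r 1≤r r≤M refl with m≤n⇒∃[o]m+o≡n r≤M
... | s , r+s≡M = begin
  φ (suc n) b           ≡⟨ cong (φ (suc n)) b≡ ⟩
  φ (suc n) (3 ^ n + s) ≡⟨ φ-second (≤-trans z<s (≤half⇒half< {n} r+s≡M r≤H)) (≤-trans (m≤n+m s r) (≤-reflexive r+s≡M)) ⟩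
  1 + φ n s             ≡⟨ cong suc (φ-reflect n 1≤r r≤H r+s≡M) ⟩
  1 + (1 + φ n r)       ≡⟨ cong suc (φ-second 1≤r r≤M) ⟨
  1 + φ (suc n) (3 ^ n + r) ∎
  where
  open ≡-Reasoning
  r≤H : r ≤ half n
  r≤H = +-cancelˡ-≤ (3 ^ n) _ _ a≤H
  b≡ : b ≡ 3 ^ n + s
  b≡ = +-cancelˡ-≡ (3 ^ n + r) _ _ (trans eq (trans (cong (λ x → 3 ^ n + (3 ^ n + (x + 0))) (sym r+s≡M)) (regroup (3 ^ n) r s)))
    where
    regroup : ∀ M r s → M + (M + ((r + s) + 0)) ≡ (M + r) + (M + s)
    regroup = solve-∀
φ-reflect (suc n) {a} {b} 1≤a _ eq | first a≤M with m≤n⇒m<n∨m≡n a≤M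
-- Here `b` is twice 3 ^ n, which ends the second range instead of opening the third.
... | inj₂ refl = begin
  φ (suc n) b               ≡⟨ cong (φ (suc n)) (trans (+-cancelˡ-≡ (3 ^ n) _ _ eq) (cong (3 ^ n +_) (+-identityʳ (3 ^ n)))) ⟩
  φ (suc n) (3 ^ n + 3 ^ n) ≡⟨ φ-second (1≤3^n n) ≤-refl ⟩
  1 + φ n (3 ^ n)           ≡⟨ cong suc (φ-first ≤-refl) ⟨
  1 + φ (suc n) (3 ^ n)     ∎
  where open ≡-Reasoning
... | inj₁ a<M with excess a<M
... | s , 1≤s , M≡a+s = begin
  φ (suc n) b                     ≡⟨ cong (φ (suc n)) b≡ ⟩
  φ (suc n) (3 ^ n + (3 ^ n + s)) ≡⟨ φ-third 1≤s (≤-trans (m≤n+m s a) (≤-reflexive (sym M≡a+s))) ⟩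
  gap n s + φ n s                 ≡⟨ level-n ⟩
  1 + φ n a                       ≡⟨ cong suc (φ-first a≤M) ⟨
  1 + φ (suc n) a                 ∎
  where
  open ≡-Reasoning
  b≡ : b ≡ 3 ^ n + (3 ^ n + s)
  b≡ = +-cancelˡ-≡ a _ _ (trans eq (trans (cong (λ x → 3 ^ n + (3 ^ n + (x + 0))) M≡a+s) (regroup (3 ^ n) a s)))
    where
    regroup : ∀ M a s → M + (M + ((a + s) + 0)) ≡ a + (M + (M + s))
    regroup = solve-∀
  level-n : gap n s + φ n s ≡ 1 + φ n a
  -- Exactly one of `a` and `s` is at most `half n`. If it is `a`, the gap is 0 and reflection adds
  -- 1; if it is `s`, reflection runs backwards and the gap of 2 makes up for it.
  level-n with ≤-<-connex a (half n)
  ... | inj₁ a≤H = trans (cong (_+ φ n s) (gap-> {n} (≤half⇒half< {n} (sym M≡a+s) a≤H)))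
                         (φ-reflect n 1≤a a≤H (sym M≡a+s))
  ... | inj₂ H<a = trans (cong (_+ φ n s) (gap-≤ {n} s≤H))
                         (cong suc (sym (φ-reflect n 1≤s s≤H (trans (+-comm s a) (sym M≡a+s)))))
    where
    s≤H : s ≤ half n
    s≤H = half<⇒≤half {n} (sym M≡a+s) H<a

-- Strong subadditivity

-- The summand 2 is what one joining edge inside S saves in `Φ-suc`: a single segment is at least as
-- good as two parts joined by an edge. Empty parts are excluded because `φ n 0` is 0.
StronglySubadditive : ℕ → Set
StronglySubadditive n = ∀ {a b} → 1 ≤ a → 1 ≤ b → a + b ≤ 3 ^ n → φ n (a + b) + 2 ≤ φ n a + φ n b

interchange : ∀ a b c d → (a + b) + (c + d) ≡ (a + c) + (b + d)
interchange = solve-∀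

rotate : ∀ t b a → (t + b) + a ≡ t + (a + b)
rotate = solve-∀

-- Here `x`, `y`, `z` are the values at the complements of the lengths with values `t`, `a`, `b`.
-- The names of the four lemmas tell which complements are at most half; this decides on which side
-- reflection puts the 1.
three-small : ∀ {x y z t a b} → x + 2 ≤ y + z → t ≡ 1 + x → a ≡ 1 + y → b ≡ 1 + z → t + 3 ≤ a + b
three-small {x} {y} {z} h refl refl refl = ≤-by 0 h (identity x y z)
  where
  identity : ∀ x y z → (1 + x) + 3 + (y + z) + 0 ≡ (1 + y) + (1 + z) + (x + 2)
  identity = solve-∀

two-small : ∀ {x y z t a b} → x + 2 ≤ y + z → x ≡ 1 + t → a ≡ 1 + y → b ≡ 1 + z → t + 3 ≤ a + b
two-small {y = y} {z} {t} h refl refl refl = ≤-by 2 h (identity y z t)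
  where
  identity : ∀ y z t → t + 3 + (y + z) + 2 ≡ (1 + y) + (1 + z) + ((1 + t) + 2)
  identity = solve-∀

left-small : ∀ {x y z t a b} → x + 2 ≤ y + z → x ≡ 1 + t → a ≡ 1 + y → z ≡ 1 + b → t + 3 ≤ a + b
left-small {y = y} {t = t} {b = b} h refl refl refl = ≤-by 0 h (identity y t b)
  where
  identity : ∀ y t b → t + 3 + (y + (1 + b)) + 0 ≡ (1 + y) + b + ((1 + t) + 2)
  identity = solve-∀

right-small : ∀ {x y z t a b} → x + 2 ≤ y + z → x ≡ 1 + t → y ≡ 1 + a → b ≡ 1 + z → t + 3 ≤ a + b
right-small {z = z} {t} {a} h refl refl refl = ≤-by 0 h (identity z t a)
  where
  identity : ∀ z t a → t + 3 + ((1 + a) + z) + 0 ≡ a + (1 + z) + ((1 + t) + 2)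
  identity = solve-∀

-- This is strong subadditivity for the complements of a and b, translated by φ-reflect.
φ-overlap : ∀ n → StronglySubadditive n →
  ∀ {a b t} → a ≤ 3 ^ n → b ≤ 3 ^ n → 1 ≤ t → a + b ≡ 3 ^ n + t → φ n t + 3 ≤ φ n a + φ n b
φ-overlap n subadd {a} {b} {t} a≤M b≤M 1≤t eq with m≤n⇒m<n∨m≡n a≤M | m≤n⇒m<n∨m≡n b≤M
-- If one part fills the graph, the other is `t` itself, and the 3 is the value of the full segment.
... | inj₂ refl | _ = ≤-reflexive (trans (+-comm (φ n t) 3)
  (cong₂ _+_ (sym (φ-full n)) (cong (φ n) (sym (+-cancelˡ-≡ (3 ^ n) _ _ eq)))))
... | _ | inj₂ refl = ≤-reflexive
  (cong₂ _+_ (cong (φ n) (+-cancelʳ-≡ (3 ^ n) _ _ (trans (+-comm t (3 ^ n)) (sym eq)))) (sym (φ-full n)))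
... | inj₁ a<M | inj₁ b<M with excess a<M | excess b<M
... | a′ , 1≤a′ , M≡a+a′ | b′ , 1≤b′ , M≡b+b′ = by-halves
  where
  a′+a≡M : a′ + a ≡ 3 ^ n
  a′+a≡M = trans (+-comm a′ a) (sym M≡a+a′)

  b′+b≡M : b′ + b ≡ 3 ^ n
  b′+b≡M = trans (+-comm b′ b) (sym M≡b+b′)

  -- The complement of `t` is the sum of the complements of `a` and `b`.
  t+t′≡M : t + (a′ + b′) ≡ 3 ^ n
  t+t′≡M = +-cancelˡ-≡ (3 ^ n) _ _ (trans (sym (+-assoc (3 ^ n) t _))
    (trans (cong (_+ (a′ + b′)) (sym eq)) (trans (interchange a b a′ b′) (cong₂ _+_ (sym M≡a+a′) (sym M≡b+b′)))))

  t′+t≡M : (a′ + b′) + t ≡ 3 ^ n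
  t′+t≡M = trans (+-comm (a′ + b′) t) t+t′≡M

  main : φ n (a′ + b′) + 2 ≤ φ n a′ + φ n b′
  main = subadd 1≤a′ 1≤b′ (≤-trans (m≤n+m _ t) (≤-reflexive t+t′≡M))

  x+t≤a+b : ∀ x → x ≤ 3 ^ n → x + t ≤ a + b
  x+t≤a+b x x≤M = ≤-trans (+-monoˡ-≤ t x≤M) (≤-reflexive (sym eq))

  1≤a : 1 ≤ a
  1≤a = ≤-trans 1≤t (+-cancelˡ-≤ b t a (≤-trans (x+t≤a+b b b≤M) (≤-reflexive (+-comm a b))))

  1≤b : 1 ≤ b
  1≤b = ≤-trans 1≤t (+-cancelˡ-≤ a t b (x+t≤a+b a a≤M))

  b′≤a : b′ ≤ a
  b′≤a = ≤-trans (m≤n+m b′ t) (≤-reflexive (+-cancelʳ-≡ a′ (t + b′) a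
    (trans (trans (rotate t b′ a′) t+t′≡M) M≡a+a′)))

  by-halves : φ n t + 3 ≤ φ n a + φ n b
  by-halves with ≤-<-connex (a′ + b′) (half n)
  ... | inj₁ t′≤H = three-small main
    (φ-reflect n (≤-trans 1≤a′ (m≤m+n a′ b′)) t′≤H t′+t≡M)
    (φ-reflect n 1≤a′ (≤-trans (m≤m+n a′ b′) t′≤H) a′+a≡M)
    (φ-reflect n 1≤b′ (≤-trans (m≤n+m b′ a′) t′≤H) b′+b≡M)
  ... | inj₂ H<t′ with half<⇒≤half {n} t′+t≡M H<t′
  ... | t≤H with ≤-<-connex a′ (half n) | ≤-<-connex b′ (half n)
  ... | inj₁ a′≤H | inj₁ b′≤H = two-small main (φ-reflect n 1≤t t≤H t+t′≡M)
    (φ-reflect n 1≤a′ a′≤H a′+a≡M) (φ-reflect n 1≤b′ b′≤H b′+b≡M)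
  ... | inj₁ a′≤H | inj₂ H<b′ = left-small main (φ-reflect n 1≤t t≤H t+t′≡M)
    (φ-reflect n 1≤a′ a′≤H a′+a≡M) (φ-reflect n 1≤b (half<⇒≤half {n} b′+b≡M H<b′) (sym M≡b+b′))
  -- The complements cannot both exceed half: `b′` is at most `a`, which is now small.
  ... | inj₂ H<a′ | _ with half<⇒≤half {n} a′+a≡M H<a′
  ... | a≤H = right-small main (φ-reflect n 1≤t t≤H t+t′≡M)
    (φ-reflect n 1≤a a≤H (sym M≡a+a′)) (φ-reflect n 1≤b′ (≤-trans b′≤a a≤H) b′+b≡M)

-- Arithmetic for the cases below, named after the ranges of the two parts; a carry occurs when
-- their remainders overflow a copy. `x` is the value of `φ n` at the remainder of the sum, `y` and
-- `z` are those at the remainders of the parts.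
first-first : ∀ {u x y z} → u ≡ 1 + x → x + 3 ≤ y + z → u + 2 ≤ y + z
first-first {x = x} {y = y} {z = z} refl h = ≤-by 0 h (identity x y z)
  where
  identity : ∀ x y z → (1 + x) + 2 + (y + z) + 0 ≡ (y + z) + (x + 3)
  identity = solve-∀

first-second : ∀ {u v x y z} → u ≡ 1 + x → v ≡ 1 + z → x + 2 ≤ y + z → u + 2 ≤ y + v
first-second {x = x} {y = y} {z = z} refl refl h = ≤-by 0 h (identity x y z)
  where
  identity : ∀ x y z → (1 + x) + 2 + (y + z) + 0 ≡ (y + (1 + z)) + (x + 2)
  identity = solve-∀

first-second-carry : ∀ {u v g x y z} → u ≡ g + x → g ≤ 2 → v ≡ 1 + z → x + 3 ≤ y + z → u + 2 ≤ y + v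
first-second-carry {g = g} {x = x} {y = y} {z = z} refl g≤2 refl h = ≤-by 0 (+-mono-≤ g≤2 h) (identity g x y z)
  where
  identity : ∀ g x y z → (g + x) + 2 + (2 + (y + z)) + 0 ≡ (y + (1 + z)) + (g + (x + 3))
  identity = solve-∀

first-third : ∀ {u v g g′ x y z} → u ≡ g + x → v ≡ g′ + z → g ≤ g′ → x + 2 ≤ y + z → u + 2 ≤ y + v
first-third {g = g} {g′ = g′} {x = x} {y = y} {z = z} refl refl g≤g′ h = ≤-by 0 (+-mono-≤ g≤g′ h) (identity g g′ x y z)
  where
  identity : ∀ g g′ x y z → (g + x) + 2 + (g′ + (y + z)) + 0 ≡ (y + (g′ + z)) + (g + (x + 2))
  identity = solve-∀

second-second : ∀ {u v w g x y z} → u ≡ g + x → g ≤ 2 → v ≡ 1 + y → w ≡ 1 + z → x + 2 ≤ y + z → u + 2 ≤ v + w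
second-second {g = g} {x = x} {y = y} {z = z} refl g≤2 refl refl h = ≤-by 0 (+-mono-≤ g≤2 h) (identity g x y z)
  where
  identity : ∀ g x y z → (g + x) + 2 + (2 + (y + z)) + 0 ≡ ((1 + y) + (1 + z)) + (g + (x + 2))
  identity = solve-∀

gap-≤2 : ∀ n r → gap n r ≤ 2
gap-≤2 n r with does (r ≤? half n)
... | true  = ≤-refl
... | false = z≤n

gap-antitone : ∀ n {r s} → r ≤ s → gap n s ≤ gap n r
gap-antitone n {r} {s} r≤s with ≤-<-connex s (half n)
... | inj₁ s≤H = ≤-reflexive (trans (gap-≤ {n} s≤H) (sym (gap-≤ {n} (≤-trans r≤s s≤H))))
... | inj₂ H<s = ≤-trans (≤-reflexive (gap-> {n} H<s)) z≤n

shift : ∀ a M r → a + (M + r) ≡ M + (a + r)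
shift = solve-∀

shift₂ : ∀ a M r → a + (M + (M + r)) ≡ M + (M + (a + r))
shift₂ = solve-∀

pair : ∀ M r s → (M + r) + (M + s) ≡ M + (M + (r + s))
pair = solve-∀

beyond : ∀ n {x y} → 1 ≤ x → y ≡ 3 ^ suc n + x → ¬ (y ≤ 3 ^ suc n)
beyond n {x} 1≤x refl p = <⇒≱ (≤-trans 1≤x
  (+-cancelˡ-≤ (3 ^ suc n) x 0 (≤-trans p (≤-reflexive (sym (+-identityʳ (3 ^ suc n))))))) z≤n

-- Induction on `n`, comparing remainders within a copy. If they fit into one copy, the hypothesis
-- applies to them; if they overflow it, `φ-overlap` yields 3 instead of 2, which pays for entering
-- the next copy.
φ-strongly-subadditive : ∀ n → StronglySubadditive n

first+any : ∀ n {a b} → 1 ≤ a → a ≤ 3 ^ n → 1 ≤ b → a + b ≤ 3 ^ suc n → Position n b →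
            φ (suc n) (a + b) + 2 ≤ φ n a + φ (suc n) b
first+any n {a} {b} 1≤a a≤M 1≤b a+b≤ (first b≤M) with a + b ≤? 3 ^ n
... | yes a+b≤M = subst₂ _≤_ (cong (_+ 2) (sym (φ-first a+b≤M))) (cong (φ n a +_) (sym (φ-first b≤M)))
        (φ-strongly-subadditive n 1≤a 1≤b a+b≤M)
... | no a+b≰M with excess (≰⇒> a+b≰M)
... | t , 1≤t , a+b≡M+t = subst (λ x → φ (suc n) (a + b) + 2 ≤ φ n a + x) (sym (φ-first b≤M))
  (first-first {y = φ n a} (trans (cong (φ (suc n)) a+b≡M+t) (φ-second 1≤t t≤M))
    (φ-overlap n (φ-strongly-subadditive n) a≤M b≤M 1≤t a+b≡M+t))
  where
  t≤M : t ≤ 3 ^ n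
  t≤M = +-cancelˡ-≤ (3 ^ n) t (3 ^ n) (≤-trans (≤-reflexive (sym a+b≡M+t)) (+-mono-≤ a≤M b≤M))
first+any n {a} 1≤a a≤M _ a+b≤ (second r 1≤r r≤M refl) with a + r ≤? 3 ^ n
... | yes a+r≤M = first-second
        (trans (cong (φ (suc n)) (shift a (3 ^ n) r)) (φ-second (≤-trans 1≤a (m≤m+n a r)) a+r≤M))
        (φ-second 1≤r r≤M)
        (φ-strongly-subadditive n 1≤a 1≤r a+r≤M)
-- The sum enters the third copy. Its gap of at most 2 is covered by the surplus 1 of `φ-overlap`
-- and the 1 of `φ-second`.
... | no a+r≰M with excess (≰⇒> a+r≰M)
... | t , 1≤t , a+r≡M+t = first-second-carry
  (trans (cong (φ (suc n)) a+b≡) (φ-third 1≤t t≤M)) (gap-≤2 n t) (φ-second 1≤r r≤M)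
  (φ-overlap n (φ-strongly-subadditive n) a≤M r≤M 1≤t a+r≡M+t)
  where
  t≤M : t ≤ 3 ^ n
  t≤M = +-cancelˡ-≤ (3 ^ n) t (3 ^ n) (≤-trans (≤-reflexive (sym a+r≡M+t)) (+-mono-≤ a≤M r≤M))
  a+b≡ : a + (3 ^ n + r) ≡ 3 ^ n + (3 ^ n + t)
  a+b≡ = trans (shift a (3 ^ n) r) (cong (3 ^ n +_) a+r≡M+t)
-- The bound on the sum rules out an overflow, and the gap does not increase from `r` to `a + r`.
first+any n {a} 1≤a a≤M _ a+b≤ (third r 1≤r r≤M refl) = first-third
  (trans (cong (φ (suc n)) (shift₂ a (3 ^ n) r)) (φ-third (≤-trans 1≤a (m≤m+n a r)) a+r≤M))
  (φ-third 1≤r r≤M)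
  (gap-antitone n (m≤n+m r a))
  (φ-strongly-subadditive n 1≤a 1≤r a+r≤M)
  where
  a+r≤M : a + r ≤ 3 ^ n
  a+r≤M = third-bound n (subst (_≤ 3 ^ suc n) (shift₂ a (3 ^ n) r) a+b≤)

any+first : ∀ n {a b} → 1 ≤ a → 1 ≤ b → b ≤ 3 ^ n → a + b ≤ 3 ^ suc n → Position n a →
            φ (suc n) (a + b) + 2 ≤ φ (suc n) a + φ (suc n) b
any+first n {a} {b} 1≤a 1≤b b≤M a+b≤ pos-a = subst₂ _≤_ (cong (λ x → φ (suc n) x + 2) (+-comm b a))
  (trans (cong (_+ φ (suc n) a) (sym (φ-first b≤M))) (+-comm (φ (suc n) b) (φ (suc n) a)))
  (first+any n 1≤b b≤M 1≤a (subst (_≤ 3 ^ suc n) (+-comm a b) a+b≤) pos-a)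

φ-strongly-subadditive zero 1≤a 1≤b a+b≤1 = contradiction (≤-trans (+-mono-≤ 1≤a 1≤b) a+b≤1) λ { (s≤s ()) }
φ-strongly-subadditive (suc n) {a} {b} 1≤a 1≤b a+b≤
  with position n {a} (≤-trans (m≤m+n a b) a+b≤) | position n {b} (≤-trans (m≤n+m b a) a+b≤)
... | first a≤M | pos-b = subst (λ x → φ (suc n) (a + b) + 2 ≤ x + φ (suc n) b) (sym (φ-first a≤M))
        (first+any n 1≤a a≤M 1≤b a+b≤ pos-b)
... | second r 1≤r r≤M eq | first b≤M = any+first n 1≤a 1≤b b≤M a+b≤ (second r 1≤r r≤M eq)
... | third r 1≤r r≤M eq  | first b≤M = any+first n 1≤a 1≤b b≤M a+b≤ (third r 1≤r r≤M eq)
... | second r 1≤r r≤M refl | second s 1≤s s≤M refl = second-second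
  (trans (cong (φ (suc n)) (pair (3 ^ n) r s)) (φ-third (≤-trans 1≤r (m≤m+n r s)) r+s≤M)) (gap-≤2 n (r + s))
  (φ-second 1≤r r≤M) (φ-second 1≤s s≤M) (φ-strongly-subadditive n 1≤r 1≤s r+s≤M)
  where
  r+s≤M : r + s ≤ 3 ^ n
  r+s≤M = third-bound n (subst (_≤ 3 ^ suc n) (pair (3 ^ n) r s) a+b≤)
-- In the remaining cases the two parts exceed three copies.
... | second r 1≤r _ refl | third s _ _ refl =
  contradiction a+b≤ (beyond n (≤-trans 1≤r (m≤m+n r s)) (regroup (3 ^ n) r s))
  where
  regroup : ∀ M r s → (M + r) + (M + (M + s)) ≡ (M + (M + (M + 0))) + (r + s)
  regroup = solve-∀
... | third r 1≤r _ refl | second s _ _ refl =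
  contradiction a+b≤ (beyond n (≤-trans 1≤r (m≤m+n r s)) (regroup (3 ^ n) r s))
  where
  regroup : ∀ M r s → (M + (M + r)) + (M + s) ≡ (M + (M + (M + 0))) + (r + s)
  regroup = solve-∀
... | third r 1≤r _ refl | third s _ _ refl =
  contradiction a+b≤ (beyond n (≤-trans 1≤r (m≤m+n r _)) (regroup (3 ^ n) r s))
  where
  regroup : ∀ M r s → (M + (M + r)) + (M + (M + s)) ≡ (M + (M + (M + 0))) + (r + (M + s))
  regroup = solve-∀

-- Raising the value of φ at 0 from 0 to 2 makes strong subadditivity and reflection hold
-- for empty parts as well.
ψ : ℕ → ℕ → ℕ
ψ n zero    = 2
ψ n (suc a) = φ n (suc a)

ψ-strongly-subadditive : ∀ n a b → a + b ≤ 3 ^ n → ψ n (a + b) + 2 ≤ ψ n a + ψ n b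
ψ-strongly-subadditive n zero    b       _  = ≤-reflexive (+-comm (ψ n b) 2)
ψ-strongly-subadditive n (suc a) zero    _  = ≤-reflexive (cong (λ x → φ n (suc x) + 2) (+-identityʳ a))
ψ-strongly-subadditive n (suc a) (suc b) p  = φ-strongly-subadditive n z<s z<s p

ψ-reflect : ∀ n {a b} → a ≤ half n → a + b ≡ 3 ^ n → φ n b ≡ 1 + ψ n a
ψ-reflect n {zero}  _   refl = φ-full n
ψ-reflect n {suc a} a≤H eq   = φ-reflect n z<s a≤H eq

ψ-first : ∀ {n a} → a ≤ 3 ^ n → ψ (suc n) a ≡ ψ n a
ψ-first {a = zero}  _   = refl
ψ-first {a = suc a} a≤M = φ-first a≤M

-- Gluing two and three parts

φ-subadditive : ∀ n a b → a + b ≤ 3 ^ n → φ n (a + b) ≤ φ n a + φ n b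
φ-subadditive n zero    b       _ = m≤n+m (φ n b) (φ n 0)
φ-subadditive n (suc a) zero    _ = ≤-trans (≤-reflexive (cong (φ n ∘ suc) (+-identityʳ a))) (m≤m+n _ _)
φ-subadditive n (suc a) (suc b) p = ≤-trans (m≤m+n _ 2) (φ-strongly-subadditive n z<s z<s p)

-- `k` tells whether a joining edge is to be credited; only then do both parts have to be nonempty.
φ-joined : ∀ n {a b} k → (k ≡ true → 1 ≤ a × 1 ≤ b) → a + b ≤ 3 ^ n →
           φ n (a + b) + 2 * bit k ≤ φ n a + φ n b
φ-joined n {a} {b} false _  p = ≤-trans (≤-reflexive (+-identityʳ _)) (φ-subadditive n a b p)
φ-joined n         true  ne p with ne refl
... | 1≤a , 1≤b = φ-strongly-subadditive n 1≤a 1≤b p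

-- Two gluings cost 2 each, so at most two of the three bonds are paid for here.
φ-joined₃ : ∀ n {a b c} e f g →
  (e ≡ true → 1 ≤ a × 1 ≤ b) → (f ≡ true → 1 ≤ a × 1 ≤ c) → (g ≡ true → 1 ≤ b × 1 ≤ c) →
  a + (b + c) ≤ 3 ^ n →
  φ n (a + (b + c)) + 2 * (2 ⊓ (bit e + (bit f + bit g))) ≤ φ n a + (φ n b + φ n c)
φ-joined₃ n {a} {b} {c} e f g ne nf ng p =
  -- Gluing `a` to the rest is credited with `e` or `f`, gluing `b` to `c` with `g` or else with the
  -- second of `e` and `f`. The latter credit is legitimate because `e` and `f` already make `b` and
  -- `c` nonempty.
  combine {p = φ n a} {φ n b} {φ n c} {φ n (a + (b + c))} {y = φ n (b + c)} {u = bit (e ∨ f)} {v = bit (g ∨ (e ∧ f))} (count e f g)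
    (φ-joined n (e ∨ f) (outer e f ne nf) p)
    (φ-joined n (g ∨ (e ∧ f)) (inner e f g ne nf ng) (≤-trans (m≤n+m (b + c) a) p))
  where
  count : ∀ e f g → bit (e ∨ f) + bit (g ∨ (e ∧ f)) ≡ 2 ⊓ (bit e + (bit f + bit g))
  count true  true  true  = refl
  count true  true  false = refl
  count true  false true  = refl
  count true  false false = refl
  count false true  true  = refl
  count false true  false = refl
  count false false true  = refl
  count false false false = refl

  outer : ∀ e f → (e ≡ true → 1 ≤ a × 1 ≤ b) → (f ≡ true → 1 ≤ a × 1 ≤ c) →
          e ∨ f ≡ true → 1 ≤ a × 1 ≤ b + c
  outer true  _    ne nf _ = let (1≤a , 1≤b) = ne refl in 1≤a , ≤-trans 1≤b (m≤m+n b c)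
  outer false true ne nf _ = let (1≤a , 1≤c) = nf refl in 1≤a , ≤-trans 1≤c (m≤n+m c b)

  inner : ∀ e f g → (e ≡ true → 1 ≤ a × 1 ≤ b) → (f ≡ true → 1 ≤ a × 1 ≤ c) →
          (g ≡ true → 1 ≤ b × 1 ≤ c) → g ∨ (e ∧ f) ≡ true → 1 ≤ b × 1 ≤ c
  inner _    _    true  ne nf ng _ = ng refl
  inner true true false ne nf ng _ = proj₂ (ne refl) , proj₂ (nf refl)

  combine : ∀ {k p q r x y u v} → u + v ≡ k → x + 2 * u ≤ p + y → y + 2 * v ≤ q + r →
            x + 2 * k ≤ p + (q + r)
  combine {p = p} {q} {r} {x} {y} {u} {v} refl h₁ h₂ = ≤-by 0 (+-mono-≤ h₁ h₂) (identity p q r x y u v)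
    where
    identity : ∀ p q r x y u v →
      x + 2 * (u + v) + ((p + y) + (q + r)) + 0 ≡ p + (q + r) + ((x + 2 * u) + (y + 2 * v))
    identity = solve-∀

-- The complements are at most `half n` each, hence together at most `half (suc n)`, so all four
-- lengths can be reflected. Two strong subadditivities for the complements give 4, and reflection
-- adds 1 on the left against 3 on the right. Full copies have empty complements, whence `ψ`.
φ-large₃ : ∀ n {a b c} → half n < a → a ≤ 3 ^ n → half n < b → b ≤ 3 ^ n → half n < c → c ≤ 3 ^ n →
  φ (suc n) (a + (b + c)) + 6 ≤ φ n a + (φ n b + φ n c)
φ-large₃ n {a} {b} {c} H<a a≤M H<b b≤M H<c c≤M
  with m≤n⇒∃[o]m+o≡n a≤M | m≤n⇒∃[o]m+o≡n b≤M | m≤n⇒∃[o]m+o≡n c≤M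
... | a′ , a+a′≡M | b′ , b+b′≡M | c′ , c+c′≡M =
  combine {x = ψ (suc n) (a′ + (b′ + c′))} {y = ψ (suc n) (b′ + c′)}
    (ψ-reflect (suc n) s′≤H s′+s≡3M)
    (reflect a+a′≡M H<a) (reflect b+b′≡M H<b) (reflect c+c′≡M H<c)
    (ψ-strongly-subadditive (suc n) a′ (b′ + c′) s′≤3M)
    (ψ-strongly-subadditive (suc n) b′ c′ (≤-trans (m≤n+m (b′ + c′) a′) s′≤3M))
  where
  reflect : ∀ {x x′} → x + x′ ≡ 3 ^ n → half n < x → φ n x ≡ 1 + ψ (suc n) x′
  reflect {x} {x′} eq H<x = trans (ψ-reflect n x′≤H (trans (+-comm x′ x) eq))
    (cong suc (sym (ψ-first (≤-trans x′≤H (<⇒≤ (half<3^n n))))))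
    where
    x′≤H : x′ ≤ half n
    x′≤H = half<⇒≤half {n} eq H<x

  2H≤M : half n + half n ≤ 3 ^ n
  2H≤M = ≤-trans (n≤1+n _) (≤-reflexive (sym (3^n-odd n)))

  s′≤H : a′ + (b′ + c′) ≤ half (suc n)
  s′≤H = ≤-trans (≤-reflexive (sym (+-assoc a′ b′ c′)))
    (+-mono-≤ (≤-trans (+-mono-≤ (half<⇒≤half {n} a+a′≡M H<a) (half<⇒≤half {n} b+b′≡M H<b)) 2H≤M)
              (half<⇒≤half {n} c+c′≡M H<c))

  s′≤3M : a′ + (b′ + c′) ≤ 3 ^ suc n
  s′≤3M = ≤-trans s′≤H (<⇒≤ (half<3^n (suc n)))

  s′+s≡3M : a′ + (b′ + c′) + (a + (b + c)) ≡ 3 ^ suc n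
  s′+s≡3M = trans (regroup a b c a′ b′ c′)
    (cong₂ _+_ a+a′≡M (cong₂ _+_ b+b′≡M (trans c+c′≡M (sym (+-identityʳ (3 ^ n))))))
    where
    regroup : ∀ a b c a′ b′ c′ →
      a′ + (b′ + c′) + (a + (b + c)) ≡ (a + a′) + ((b + b′) + (c + c′))
    regroup = solve-∀

  combine : ∀ {s t u v x y p q r} → s ≡ 1 + x → t ≡ 1 + p → u ≡ 1 + q → v ≡ 1 + r →
            x + 2 ≤ p + y → y + 2 ≤ q + r → s + 6 ≤ t + (u + v)
  combine {x = x} {y} {p} {q} {r} refl refl refl refl h₁ h₂ =
    ≤-by 0 (+-mono-≤ h₁ h₂) (identity x y p q r)
    where
    identity : ∀ x y p q r → (1 + x) + 6 + ((p + y) + (q + r)) + 0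
                           ≡ (1 + p) + ((1 + q) + (1 + r)) + ((x + 2) + (y + 2))
    identity = solve-∀

-- Initial segments minimise Φ

size-≤ : ∀ n (S : Set[ n ]) → size n S ≤ 3 ^ n
size-≤ n S = ≤-trans (m≤n+m _ (size n (not ∘ S))) (≤-reflexive (size-∁ n S))

size-nonempty : ∀ {n} (S : Set[ n ]) w → S w ≡ true → 1 ≤ size n S
size-nonempty {n} S w Sw = subst (λ b → bit b ≤ size n S) Sw (∑-≥ (bit ∘ S) w)

SegmentsOptimal : ℕ → Set
SegmentsOptimal n = ∀ S → φ n (size n S) ≤ Φ n S

-- The complement has Φ at least 1 + `φ n (size n S)` by optimality and reflection. With k ≥ 2
-- corners in S, its Φ is also Φ(S) + 3 - 2k, at most Φ(S) - 1.
Φ-cornered : ∀ n → SegmentsOptimal n → ∀ S → 1 ≤ size n S → size n S ≤ half n → 2 ≤ corners n S →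
             φ n (size n S) + 2 ≤ Φ n S
Φ-cornered n optimal S 1≤a a≤H 2≤k = arith
  (subst (_≤ Φ n (not ∘ S)) (φ-reflect n 1≤a a≤H a+a′≡M) (optimal (not ∘ S))) 2≤k (Φ-∁ n S)
  where
  a+a′≡M : size n S + size n (not ∘ S) ≡ 3 ^ n
  a+a′≡M = trans (+-comm (size n S) _) (size-∁ n S)

  arith : ∀ {x w k z} → 1 + x ≤ w → 2 ≤ k → w + 2 * k ≡ z + 3 → x + 2 ≤ z
  arith {x} {w} {k} {z} h 2≤k eq =
    ≤-by 0 (≤-trans (+-mono-≤ h (*-monoʳ-≤ 2 2≤k)) (≤-reflexive eq)) (identity x z)
    where
    identity : ∀ x z → x + 2 + (z + 3) + 0 ≡ z + ((1 + x) + 4)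
    identity = solve-∀

all-or-two : ∀ e f g → (e ≡ true × f ≡ true × g ≡ true)
                     ⊎ 2 ⊓ (bit e + (bit f + bit g)) ≡ bit e + (bit f + bit g)
all-or-two true  true  true  = inj₁ (refl , refl , refl)
all-or-two true  true  false = inj₂ refl
all-or-two true  false true  = inj₂ refl
all-or-two true  false false = inj₂ refl
all-or-two false true  true  = inj₂ refl
all-or-two false true  false = inj₂ refl
all-or-two false false true  = inj₂ refl
all-or-two false false false = inj₂ refl

segments-optimal : ∀ n → SegmentsOptimal n
segments-optimal zero S = on-vertex (S [])
  where
  on-vertex : ∀ b → φ 0 (bit b) ≤ bit b + (bit b + bit b)
  on-vertex true  = ≤-reflexive (φ-full 0)
  on-vertex false = ≤-reflexive (φ-zero 0)
segments-optimal (suc n) S = +-cancelʳ-≤ (2 * across bond S) _ _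
  (≤-trans enough (≤-reflexive (sym (Φ-suc n S))))
  where
  A : Fin 3 → Set[ n ]
  A i = S ∘ (i ∷_)

  a F : Fin 3 → ℕ
  a i = size n (A i)
  F i = Φ n (A i)

  x : Fin 3 → Fin 3 → Bool
  x i j = A i (corner n j)

  φF : ∀ i → φ n (a i) ≤ F i
  φF i = segments-optimal n (A i)

  nonempty : ∀ i j → x i j ∧ x j i ≡ true → 1 ≤ a i × 1 ≤ a j
  nonempty i j eq = size-nonempty (A i) _ (Bool.∧-conicalˡ (x i j) _ eq) ,
                    size-nonempty (A j) _ (Bool.∧-conicalʳ (x i j) _ eq)

  total : ℕ
  total = size (suc n) S

  φ-first₃ : φ (suc n) (a 0F) + (φ (suc n) (a 1F) + φ (suc n) (a 2F))
           ≡ φ n (a 0F) + (φ n (a 1F) + φ n (a 2F))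
  φ-first₃ = cong₂ _+_ (φ-first (size-≤ n (A 0F)))
    (cong₂ _+_ (φ-first (size-≤ n (A 1F))) (φ-first (size-≤ n (A 2F))))

  two-bonds : φ (suc n) total + 2 * (2 ⊓ across bond S) ≤ φ n (a 0F) + (φ n (a 1F) + φ n (a 2F))
  -- The gluing takes place at level `suc n`, where the total size fits; `φ-first` returns the parts
  -- to level `n`.
  two-bonds = ≤-trans
    (φ-joined₃ (suc n) (x 0F 1F ∧ x 1F 0F) (x 0F 2F ∧ x 2F 0F) (x 1F 2F ∧ x 2F 1F)
      (nonempty 0F 1F) (nonempty 0F 2F) (nonempty 1F 2F) (size-≤ (suc n) S))
    (≤-reflexive φ-first₃)

  φF₀ : ∀ i → φ n (a i) + 0 ≤ F i
  φF₀ i = ≤-trans (≤-reflexive (+-identityʳ _)) (φF i)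

  -- `i`, `j`, `k` are the improvements over the optimal bound in the three copies; a total of 2
  -- supplies what the third edge costs.
  raise : ∀ {s p q r P Q R} i j k → i + (j + k) ≡ 2 →
          s + 4 ≤ p + (q + r) → p + i ≤ P → q + j ≤ Q → r + k ≤ R → s + 6 ≤ P + (Q + R)
  raise {s} {p} {q} {r} {P} {Q} {R} i j k i+j+k≡2 h hp hq hr =
    ≤-by 0 (+-mono-≤ h (+-mono-≤ hp (+-mono-≤ hq hr)))
      (trans (cong (λ m → s + (4 + m) + (p + (q + r) + (P + (Q + R))) + 0) (sym i+j+k≡2)) (identity s p q r P Q R i j k))
    where
    identity : ∀ s p q r P Q R i j k →
      s + (4 + (i + (j + k))) + ((p + (q + r)) + (P + (Q + R))) + 0
        ≡ P + (Q + R) + ((s + 4) + ((p + i) + ((q + j) + (r + k))))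
    identity = solve-∀

  module ThreeBonds (e : x 0F 1F ∧ x 1F 0F ≡ true) (f : x 0F 2F ∧ x 2F 0F ≡ true)
                    (g : x 1F 2F ∧ x 2F 1F ≡ true) where

    three : across bond S ≡ 3
    three = cong₂ _+_ (cong bit e) (cong₂ _+_ (cong bit f) (cong bit g))

    four : φ (suc n) total + 4 ≤ φ n (a 0F) + (φ n (a 1F) + φ n (a 2F))
    four = subst (λ k → φ (suc n) total + 2 * (2 ⊓ k) ≤ φ n (a 0F) + (φ n (a 1F) + φ n (a 2F))) three two-bonds

    bit-true : ∀ {b} → b ≡ true → 1 ≤ bit b
    bit-true refl = ≤-refl

    x₀₁ : 1 ≤ bit (x 0F 1F)
    x₀₁ = bit-true (Bool.∧-conicalˡ (x 0F 1F) _ e)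
    x₁₀ : 1 ≤ bit (x 1F 0F)
    x₁₀ = bit-true (Bool.∧-conicalʳ (x 0F 1F) _ e)
    x₀₂ : 1 ≤ bit (x 0F 2F)
    x₀₂ = bit-true (Bool.∧-conicalˡ (x 0F 2F) _ f)
    x₂₀ : 1 ≤ bit (x 2F 0F)
    x₂₀ = bit-true (Bool.∧-conicalʳ (x 0F 2F) _ f)
    x₁₂ : 1 ≤ bit (x 1F 2F)
    x₁₂ = bit-true (Bool.∧-conicalˡ (x 1F 2F) _ g)
    x₂₁ : 1 ≤ bit (x 2F 1F)
    x₂₁ = bit-true (Bool.∧-conicalʳ (x 1F 2F) _ g)

    cornered : ∀ i → 1 ≤ a i → 2 ≤ corners n (A i) → a i ≤ half n → φ n (a i) + 2 ≤ F i
    cornered i 1≤a 2≤k a≤H = Φ-cornered n (segments-optimal n) (A i) 1≤a a≤H 2≤k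

    six : φ (suc n) total + 6 ≤ F 0F + (F 1F + F 2F)
    -- Three edges inside S put two corners of every copy into its trace, so the first trace that is
    -- at most half gains 2 from `cornered`.
    six with ≤-<-connex (a 0F) (half n) | ≤-<-connex (a 1F) (half n) | ≤-<-connex (a 2F) (half n)
    ... | inj₁ a₀≤H | _ | _ = raise 2 0 0 refl four
          (cornered 0F (proj₁ (nonempty 0F 1F e))
            (m≤n⇒m≤o+n (bit (x 0F 0F)) (+-mono-≤ x₀₁ x₀₂)) a₀≤H)
          (φF₀ 1F) (φF₀ 2F)
    ... | inj₂ _ | inj₁ a₁≤H | _ = raise 0 2 0 refl four (φF₀ 0F)
          (cornered 1F (proj₁ (nonempty 1F 2F g))
            (+-mono-≤ x₁₀ (m≤n⇒m≤o+n (bit (x 1F 1F)) x₁₂)) a₁≤H)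
          (φF₀ 2F)
    ... | inj₂ _ | inj₂ _ | inj₁ a₂≤H = raise 0 0 2 refl four (φF₀ 0F) (φF₀ 1F)
          (cornered 2F (proj₂ (nonempty 1F 2F g))
            (+-mono-≤ x₂₀ (m≤n⇒m≤n+o (bit (x 2F 2F)) x₂₁)) a₂≤H)
    ... | inj₂ H<a₀ | inj₂ H<a₁ | inj₂ H<a₂ = ≤-trans
          (φ-large₃ n H<a₀ (size-≤ n (A 0F)) H<a₁ (size-≤ n (A 1F)) H<a₂ (size-≤ n (A 2F)))
          (+-mono-≤ (φF 0F) (+-mono-≤ (φF 1F) (φF 2F)))

  enough : φ (suc n) total + 2 * across bond S ≤ F 0F + (F 1F + F 2F)
  enough with all-or-two (x 0F 1F ∧ x 1F 0F) (x 0F 2F ∧ x 2F 0F) (x 1F 2F ∧ x 2F 1F)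
  ... | inj₁ (e , f , g) = subst (λ k → φ (suc n) total + 2 * k ≤ F 0F + (F 1F + F 2F))
        (sym (ThreeBonds.three e f g)) (ThreeBonds.six e f g)
  ... | inj₂ ≤2 = ≤-trans
        (subst (λ k → φ (suc n) total + 2 * k ≤ φ n (a 0F) + (φ n (a 1F) + φ n (a 2F))) ≤2 two-bonds)
        (+-mono-≤ (φF 0F) (+-mono-≤ (φF 1F) (φF 2F)))

-- From `Φ` back to the edge boundary

corners-seg : ∀ {n ℓ k₀ k₁ k₂} → seg n ℓ (corner n 0F) ≡ k₀ → seg n ℓ (corner n 1F) ≡ k₁ →
  seg n ℓ (corner n 2F) ≡ k₂ → corners n (seg n ℓ) ≡ bit k₀ + (bit k₁ + bit k₂)
corners-seg refl refl refl = refl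

-- The counterpart of `Φ-∁` with the complement replaced by the segment of complementary length. It
-- follows from reflection, as a proper nonempty segment has one corner up to `half n` and two
-- beyond.
φ-∁ : ∀ n {ℓ ℓ′} → ℓ + ℓ′ ≡ 3 ^ n → φ n ℓ′ + 2 * corners n (seg n ℓ) ≡ φ n ℓ + 3
φ-∁ n {zero} refl = trans
  (cong₂ (λ p k → p + 2 * k) (φ-full n)
    (corners-seg {n} (seg-empty (corner n 0F)) (seg-empty (corner n 1F)) (seg-empty (corner n 2F))))
  (cong (_+ 3) (sym (φ-zero n)))
φ-∁ n {ℓ@(suc _)} {zero} eq with trans (sym (+-identityʳ ℓ)) eq
... | ℓ≡M = trans
  (cong₂ (λ p k → p + 2 * k) (φ-zero n) (subst (λ m → corners n (seg n m) ≡ 3) (sym ℓ≡M)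
    (corners-seg {n} (seg-full (corner n 0F)) (seg-full (corner n 1F)) (seg-full (corner n 2F)))))
  (cong (_+ 3) (sym (trans (cong (φ n) ℓ≡M) (φ-full n))))
φ-∁ n {ℓ@(suc _)} {ℓ′@(suc _)} eq with ≤-<-connex ℓ (half n)
... | inj₁ ℓ≤H = one (φ-reflect n z<s ℓ≤H eq)
  (corners-seg {n} (seg-corner₀ z<s) (seg-corner₁-false ℓ≤H)
    (seg-corner₂-false (≤-trans (s≤s ℓ≤H) (half<3^n n))))
  where
  one : ∀ {p q k} → p ≡ 1 + q → k ≡ 1 → p + 2 * k ≡ q + 3
  one {q = q} refl refl = identity q
    where
    identity : ∀ q → 1 + q + 2 ≡ q + 3
    identity = solve-∀
... | inj₂ H<ℓ = two (φ-reflect n z<s (half<⇒≤half {n} eq H<ℓ) (trans (+-comm ℓ′ ℓ) eq))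
  (corners-seg {n} (seg-corner₀ z<s) (seg-corner₁-true H<ℓ)
    (seg-corner₂-false (≤-trans (m<m+n ℓ z<s) (≤-reflexive eq))))
  where
  two : ∀ {p q k} → q ≡ 1 + p → k ≡ 2 → p + 2 * k ≡ q + 3
  two {p} refl refl = identity p
    where
    identity : ∀ p → p + 4 ≡ 1 + p + 3
    identity = solve-∀

-- Adding the optimality inequalities for S and for its complement cancels the corner counts, in
-- which S and the segment may differ.
θ-segment-minimal : ∀ n S → θ n (seg n (size n S)) ≤ θ n S
θ-segment-minimal n S = arith
  (subst (_≤ θ n S + corners n S) (φ≡Φ-seg n ℓ) (segments-optimal n S))
  (segments-optimal n (not ∘ S)) (Φ-∁ n S)
  (trans (φ-∁ n (trans (+-comm ℓ _) (size-∁ n S))) (cong (_+ 3) (φ≡Φ-seg n ℓ)))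
  where
  ℓ : ℕ
  ℓ = size n S

  arith : ∀ {t k t′ k′ p q} → t + k ≤ t′ + k′ → p ≤ q → q + 2 * k′ ≡ (t′ + k′) + 3 →
          p + 2 * k ≡ (t + k) + 3 → t ≤ t′
  arith {t} {k} {t′} {k′} {p} {q} h p≤q eq eq′ = *-cancelˡ-≤ 2 (≤-by 0
    (+-mono-≤ h (+-mono-≤ (+-monoˡ-≤ (2 * k + 2 * k′) p≤q) (≤-reflexive (cong₂ _+_ eq (sym eq′)))))
    (identity t k t′ k′ p q))
    where
    identity : ∀ t k t′ k′ p q →
      2 * t + ((t′ + k′) + ((q + (2 * k + 2 * k′)) + (((t′ + k′) + 3) + (p + 2 * k)))) + 0
        ≡ 2 * t′ + ((t + k) + ((p + (2 * k + 2 * k′)) + ((q + 2 * k′) + ((t + k) + 3))))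
    identity = solve-∀

theorem8 : (n : ℕ) → 1 ≤ n → (ℓ : ℕ) → ℓ ≤ 3 ^ n →
    let open FiniteGraph (Sierpinski n 3) in
    IsMinimumOf ∣Θ Lex⁻¹[1⋯ ℓ ] ∣ (λ k → ∃[ S ] (∣ S ∣ ≡ ℓ × k ≡ ∣Θ S ∣))
theorem8 n _ ℓ ℓ≤3^n = (Lex⁻¹[1⋯ ℓ ] , size-Lex , refl) , minimal
  where
  size-Lex : card n Lex⁻¹[1⋯ ℓ ] ≡ ℓ
  size-Lex = trans (card-∑ n _) (trans (∑-cong n (cong bit ∘ Lex⁻¹≗seg ℓ)) (size-seg n ℓ≤3^n))

  minimal : ∀ j → ∃[ S ] (card n S ≡ ℓ × j ≡ boundary n S) → boundary n Lex⁻¹[1⋯ ℓ ] ≤ j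
  minimal _ (S , ∣S∣≡ℓ , refl) = begin
    boundary n Lex⁻¹[1⋯ ℓ ]    ≡⟨ boundary≡θ n _ ⟩
    θ n Lex⁻¹[1⋯ ℓ ]         ≡⟨ θ-cong n (Lex⁻¹≗seg ℓ) ⟩
    θ n (seg n ℓ)            ≡⟨ cong (λ m → θ n (seg n m)) (trans (sym ∣S∣≡ℓ) (card-∑ n S)) ⟩
    θ n (seg n (size n S))   ≤⟨ θ-segment-minimal n S ⟩
    θ n S                    ≡⟨ boundary≡θ n S ⟨
    boundary n S               ∎
    where open ≤-Reasoning
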